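{- Any quantum algorithm that solves the metric estimation problem on $n$ points with an approximation factor smaller than $3$ needs to make at least $\Omega(n^2)$ oracle calls.
   Context: Metric estimation: input is a metric space $\langle \mathcal{M},d\rangle$ with $\mathcal{M}=\{p_1,\dots,p_n\}$, accessible only via an oracle that on input $(i,j)$ returns $d(p_i,p_j)$. The output, with approximation factor $\alpha>1$, is an $n\times n$ matrix $A$ with $d(p_i,p_j)\le A[i][j]\le \alpha\, d(p_i,p_j)$ for all $1\le i,j\le n$. The complexity measure is the number of (quantum) oracle queries. -}

module Defs where

open import Data.Bool using (Bool; true; false; _xor_; if_then_else_)
open import Data.Fin using (Fin)
import Data.Fin.Properties as Fin
open import Data.Integer using (+_)
open import Data.List using (List; []; _∷_; foldr; map; cartesianProduct; allFin)
open import Data.Nat as ℕ using (ℕ; zero; suc)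
import Data.Nat.Properties as ℕ
open import Data.Product using (Σ-syntax; ∃-syntax; _×_; _,_)
open import Data.Product.Properties using () renaming (≡-dec to ×-≡-dec)
open import Data.Rational as ℚ using (ℚ; 0ℚ; 1ℚ; ½; Positive; positive; _/_; 1/_; ∣_∣)
import Data.Rational.Properties as ℚ
open import Data.Rational.Solver using (module +-*-Solver)
open import Data.Vec as Vec using (Vec)
open import Data.Vec.Properties using () renaming (≡-dec to Vec-≡-dec)
import Data.Bool.Properties as Bool
open import Relation.Binary.Definitions using (DecidableEquality)
open import Relation.Binary.PropositionalEquality using (_≡_; refl; sym; trans; cong; cong₂; subst)
open import Relation.Nullary.Decidable using (does)

-- Real numbers: Cauchy sequences of rationals, with equality "the
-- difference tends to 0".

IsCauchy : (ℕ → ℚ) → Set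
IsCauchy u = ∀ ε → 0ℚ ℚ.< ε → ∃[ N ] ∀ m n → N ℕ.≤ m → N ℕ.≤ n → ∣ u m ℚ.- u n ∣ ℚ.< ε

record ℝ : Set where
  constructor mkℝ
  field
    seq    : ℕ → ℚ
    cauchy : IsCauchy seq

open ℝ public

infix 4 _≈ᴿ_ _≤ᴿ_ _<ᴿ_

_≈ᴿ_ : ℝ → ℝ → Set
x ≈ᴿ y = ∀ ε → 0ℚ ℚ.< ε → ∃[ N ] ∀ n → N ℕ.≤ n → ∣ seq x n ℚ.- seq y n ∣ ℚ.< ε

_≤ᴿ_ : ℝ → ℝ → Set
x ≤ᴿ y = ∀ ε → 0ℚ ℚ.< ε → ∃[ N ] ∀ n → N ℕ.≤ n → seq x n ℚ.≤ seq y n ℚ.+ ε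

_<ᴿ_ : ℝ → ℝ → Set
x <ᴿ y = ∃[ ε ] 0ℚ ℚ.< ε × ∃[ N ] ∀ n → N ℕ.≤ n → seq x n ℚ.+ ε ℚ.≤ seq y n

private
  halve-pos : ∀ {ε} → 0ℚ ℚ.< ε → 0ℚ ℚ.< ½ ℚ.* ε
  halve-pos {ε} 0<ε = subst (ℚ._< ½ ℚ.* ε) (ℚ.*-zeroʳ ½) (ℚ.*-monoʳ-<-pos ½ {0ℚ} {ε} 0<ε)

  halves : ∀ ε → ½ ℚ.* ε ℚ.+ ½ ℚ.* ε ≡ ε
  halves ε = trans (sym (ℚ.*-distribʳ-+ ε ½ ½)) (ℚ.*-identityˡ ε)

  cancel : ∀ a b → a ≡ (a ℚ.- b) ℚ.+ b
  cancel = solve 2 (λ a b → a := (a :- b) :+ b) refl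
    where open +-*-Solver

  sum-diff : ∀ a b c d → (a ℚ.+ b) ℚ.- (c ℚ.+ d) ≡ (a ℚ.- c) ℚ.+ (b ℚ.- d)
  sum-diff = solve 4 (λ a b c d → (a :+ b) :- (c :+ d) := (a :- c) :+ (b :- d)) refl
    where open +-*-Solver

  neg-diff : ∀ a b → ℚ.- (a ℚ.- b) ≡ (ℚ.- a) ℚ.- (ℚ.- b)
  neg-diff = solve 2 (λ a b → :- (a :- b) := (:- a) :- (:- b)) refl
    where open +-*-Solver

  product-diff : ∀ a b c d → a ℚ.* b ℚ.- c ℚ.* d ≡ a ℚ.* (b ℚ.- d) ℚ.+ d ℚ.* (a ℚ.- c)
  product-diff = solve 4 (λ a b c d → a :* b :- c :* d := a :* (b :- d) :+ d :* (a :- c)) refl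
    where open +-*-Solver

  bound : ∀ x → ∃[ N ] ∃[ B ] 0ℚ ℚ.< B × (∀ n → N ℕ.≤ n → ∣ seq x n ∣ ℚ.≤ B)
  bound x with cauchy x 1ℚ (ℚ.positive⁻¹ 1ℚ)
  ... | N , c = N , 1ℚ ℚ.+ ∣ seq x N ∣
      , ℚ.+-mono-<-≤ (ℚ.positive⁻¹ 1ℚ) (ℚ.0≤∣p∣ (seq x N))
      , λ n N≤n → begin
          ∣ seq x n ∣
            ≡⟨ cong ∣_∣ (cancel (seq x n) (seq x N)) ⟩
          ∣ (seq x n ℚ.- seq x N) ℚ.+ seq x N ∣
            ≤⟨ ℚ.∣p+q∣≤∣p∣+∣q∣ (seq x n ℚ.- seq x N) (seq x N) ⟩
          ∣ seq x n ℚ.- seq x N ∣ ℚ.+ ∣ seq x N ∣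
            ≤⟨ ℚ.+-monoˡ-≤ ∣ seq x N ∣ (ℚ.<⇒≤ (c n N N≤n ℕ.≤-refl)) ⟩
          1ℚ ℚ.+ ∣ seq x N ∣ ∎
    where open ℚ.≤-Reasoning

  scaled : ∀ B → 0ℚ ℚ.< B → ∀ ε → 0ℚ ℚ.< ε → ∃[ δ ] 0ℚ ℚ.< δ × B ℚ.* δ ≡ ε
  scaled B 0<B ε 0<ε = 1/ B ℚ.* ε , 0<δ , eq
    where
    instance
      B>0  : Positive B
      B>0  = positive 0<B
      B≢0  : ℚ.NonZero B
      B≢0  = ℚ.pos⇒nonZero B
      B⁻¹>0 : Positive (1/ B)
      B⁻¹>0 = ℚ.1/pos⇒pos B
    0<δ : 0ℚ ℚ.< 1/ B ℚ.* ε
    0<δ = subst (ℚ._< 1/ B ℚ.* ε) (ℚ.*-zeroʳ (1/ B)) (ℚ.*-monoʳ-<-pos (1/ B) {0ℚ} {ε} 0<ε)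
    eq : B ℚ.* (1/ B ℚ.* ε) ≡ ε
    eq = trans (sym (ℚ.*-assoc B (1/ B) ε))
        (trans (cong (ℚ._* ε) (ℚ.*-inverseʳ B)) (ℚ.*-identityˡ ε))

  product-< : ∀ {a b B δ} → 0ℚ ℚ.< B → ∣ a ∣ ℚ.≤ B → ∣ b ∣ ℚ.< δ → ∣ a ℚ.* b ∣ ℚ.< B ℚ.* δ
  product-< {a} {b} {B} {δ} 0<B a≤B b<δ = begin-strict
    ∣ a ℚ.* b ∣       ≡⟨ ℚ.∣p*q∣≡∣p∣*∣q∣ a b ⟩
    ∣ a ∣ ℚ.* ∣ b ∣   ≤⟨ ℚ.*-monoʳ-≤-nonNeg ∣ b ∣ {{ℚ.∣-∣-nonNeg b}} a≤B ⟩
    B ℚ.* ∣ b ∣       <⟨ ℚ.*-monoʳ-<-pos B {{positive 0<B}} b<δ ⟩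
    B ℚ.* δ           ∎
    where open ℚ.≤-Reasoning

  sum-diff-< : ∀ a b c d ε → ∣ a ℚ.- c ∣ ℚ.< ½ ℚ.* ε → ∣ b ℚ.- d ∣ ℚ.< ½ ℚ.* ε →
    ∣ (a ℚ.+ b) ℚ.- (c ℚ.+ d) ∣ ℚ.< ε
  sum-diff-< a b c d ε a-c<ε/2 b-d<ε/2 = begin-strict
    ∣ (a ℚ.+ b) ℚ.- (c ℚ.+ d) ∣
      ≡⟨ cong ∣_∣ (sum-diff a b c d) ⟩
    ∣ (a ℚ.- c) ℚ.+ (b ℚ.- d) ∣
      ≤⟨ ℚ.∣p+q∣≤∣p∣+∣q∣ (a ℚ.- c) (b ℚ.- d) ⟩
    ∣ a ℚ.- c ∣ ℚ.+ ∣ b ℚ.- d ∣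
      <⟨ ℚ.+-mono-< a-c<ε/2 b-d<ε/2 ⟩
    ½ ℚ.* ε ℚ.+ ½ ℚ.* ε
      ≡⟨ halves ε ⟩
    ε ∎
    where open ℚ.≤-Reasoning

  product-diff-< : ∀ a b c d A B δ η ε → 0ℚ ℚ.< A → 0ℚ ℚ.< B →
    A ℚ.* δ ≡ ½ ℚ.* ε → B ℚ.* η ≡ ½ ℚ.* ε → ∣ a ∣ ℚ.≤ A → ∣ d ∣ ℚ.≤ B →
    ∣ b ℚ.- d ∣ ℚ.< δ → ∣ a ℚ.- c ∣ ℚ.< η → ∣ a ℚ.* b ℚ.- c ℚ.* d ∣ ℚ.< ε
  product-diff-< a b c d A B δ η ε 0<A 0<B Aδ≡ε/2 Bη≡ε/2 a≤A d≤B b-d<δ a-c<η = begin-strict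
    ∣ a ℚ.* b ℚ.- c ℚ.* d ∣
      ≡⟨ cong ∣_∣ (product-diff a b c d) ⟩
    ∣ a ℚ.* (b ℚ.- d) ℚ.+ d ℚ.* (a ℚ.- c) ∣
      ≤⟨ ℚ.∣p+q∣≤∣p∣+∣q∣ (a ℚ.* (b ℚ.- d)) (d ℚ.* (a ℚ.- c)) ⟩
    ∣ a ℚ.* (b ℚ.- d) ∣ ℚ.+ ∣ d ℚ.* (a ℚ.- c) ∣
      <⟨ ℚ.+-mono-< (product-< {a} {b ℚ.- d} 0<A a≤A b-d<δ)
                    (product-< {d} {a ℚ.- c} 0<B d≤B a-c<η) ⟩
    A ℚ.* δ ℚ.+ B ℚ.* η
      ≡⟨ cong₂ ℚ._+_ Aδ≡ε/2 Bη≡ε/2 ⟩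
    ½ ℚ.* ε ℚ.+ ½ ℚ.* ε
      ≡⟨ halves ε ⟩
    ε ∎
    where open ℚ.≤-Reasoning

-- The moduli are abstract because real numbers are compared through seq
-- only, and unfolding the moduli makes type checking very slow.
abstract
  const-cauchy : ∀ q → IsCauchy (λ _ → q)
  const-cauchy q ε 0<ε = 0 , λ _ _ _ _ →
    subst (λ r → ∣ r ∣ ℚ.< ε) (sym (ℚ.+-inverseʳ q)) 0<ε

  +-cauchy : ∀ x y → IsCauchy (λ n → seq x n ℚ.+ seq y n)
  +-cauchy x y ε 0<ε =
    let M , cx = cauchy x (½ ℚ.* ε) (halve-pos 0<ε)
        N , cy = cauchy y (½ ℚ.* ε) (halve-pos 0<ε)
    in M ℕ.⊔ N , λ m n ≤m ≤n →
      sum-diff-< (seq x m) (seq y m) (seq x n) (seq y n) ε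
        (cx m n (ℕ.m⊔n≤o⇒m≤o M N ≤m) (ℕ.m⊔n≤o⇒m≤o M N ≤n))
        (cy m n (ℕ.m⊔n≤o⇒n≤o M N ≤m) (ℕ.m⊔n≤o⇒n≤o M N ≤n))

  neg-cauchy : ∀ x → IsCauchy (λ n → ℚ.- seq x n)
  neg-cauchy x ε 0<ε =
    let N , c = cauchy x ε 0<ε
    in N , λ m n N≤m N≤n →
      subst (ℚ._< ε)
        (trans (sym (ℚ.∣-p∣≡∣p∣ (seq x m ℚ.- seq x n)))
               (cong ∣_∣ (neg-diff (seq x m) (seq x n))))
        (c m n N≤m N≤n)

  *-cauchy : ∀ x y → IsCauchy (λ n → seq x n ℚ.* seq y n)
  *-cauchy x y ε 0<ε =
    let K , A , 0<A , x≤A = bound x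
        L , B , 0<B , y≤B = bound y
        δ , 0<δ , Aδ≡ε/2  = scaled A 0<A (½ ℚ.* ε) (halve-pos 0<ε)
        η , 0<η , Bη≡ε/2  = scaled B 0<B (½ ℚ.* ε) (halve-pos 0<ε)
        M , cy            = cauchy y δ 0<δ
        N , cx            = cauchy x η 0<η
    in (K ℕ.⊔ L) ℕ.⊔ (M ℕ.⊔ N) , λ m n ≤m ≤n →
      let K⊔L≤m = ℕ.m⊔n≤o⇒m≤o (K ℕ.⊔ L) (M ℕ.⊔ N) ≤m
          M⊔N≤m = ℕ.m⊔n≤o⇒n≤o (K ℕ.⊔ L) (M ℕ.⊔ N) ≤m
          K⊔L≤n = ℕ.m⊔n≤o⇒m≤o (K ℕ.⊔ L) (M ℕ.⊔ N) ≤n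
          M⊔N≤n = ℕ.m⊔n≤o⇒n≤o (K ℕ.⊔ L) (M ℕ.⊔ N) ≤n
      in product-diff-<
           (seq x m) (seq y m) (seq x n) (seq y n) A B δ η ε 0<A 0<B Aδ≡ε/2 Bη≡ε/2
           (x≤A m (ℕ.m⊔n≤o⇒m≤o K L K⊔L≤m))
           (y≤B n (ℕ.m⊔n≤o⇒n≤o K L K⊔L≤n))
           (cy m n (ℕ.m⊔n≤o⇒m≤o M N M⊔N≤m) (ℕ.m⊔n≤o⇒m≤o M N M⊔N≤n))
           (cx m n (ℕ.m⊔n≤o⇒n≤o M N M⊔N≤m) (ℕ.m⊔n≤o⇒n≤o M N M⊔N≤n))

fromℚ : ℚ → ℝ
fromℚ q = mkℝ (λ _ → q) (const-cauchy q)

0ᴿ 1ᴿ : ℝ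
0ᴿ = fromℚ 0ℚ
1ᴿ = fromℚ 1ℚ

infixl 6 _+ᴿ_ _-ᴿ_
infixl 7 _*ᴿ_
infix  8 -ᴿ_

_+ᴿ_ : ℝ → ℝ → ℝ
x +ᴿ y = mkℝ (λ n → seq x n ℚ.+ seq y n) (+-cauchy x y)

-ᴿ_ : ℝ → ℝ
-ᴿ x = mkℝ (λ n → ℚ.- seq x n) (neg-cauchy x)

_-ᴿ_ : ℝ → ℝ → ℝ
x -ᴿ y = x +ᴿ (-ᴿ y)

_*ᴿ_ : ℝ → ℝ → ℝ
x *ᴿ y = mkℝ (λ n → seq x n ℚ.* seq y n) (*-cauchy x y)

record ℂ : Set where
  constructor _+i_
  field
    re im : ℝ

open ℂ public

infix  4 _≈ᶜ_
infixl 6 _+ᶜ_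
infixl 7 _*ᶜ_

_≈ᶜ_ : ℂ → ℂ → Set
z ≈ᶜ w = re z ≈ᴿ re w × im z ≈ᴿ im w

0ᶜ 1ᶜ : ℂ
0ᶜ = 0ᴿ +i 0ᴿ
1ᶜ = 1ᴿ +i 0ᴿ

_+ᶜ_ _*ᶜ_ : ℂ → ℂ → ℂ
z +ᶜ w = (re z +ᴿ re w) +i (im z +ᴿ im w)
z *ᶜ w = (re z *ᴿ re w -ᴿ im z *ᴿ im w) +i (re z *ᴿ im w +ᴿ im z *ᴿ re w)

conj : ℂ → ℂ
conj z = re z +i (-ᴿ im z)

∣_∣² : ℂ → ℝ
∣ z ∣² = re z *ᴿ re z +ᴿ im z *ᴿ im z

import Function.Metric.Structures as Metric

-- p₁ , … , pₙ are distinct points, so equality of points is equality of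
-- indices.
IsMetric : ∀ {n} → (Fin n → Fin n → ℝ) → Set
IsMetric {n} = Metric.IsGeneralMetric {A = Fin n} _≡_ _≈ᴿ_ _≤ᴿ_ 0ᴿ _+ᴿ_

IsEstimate : ∀ {n} → ℝ → (Fin n → Fin n → ℝ) → (Fin n → Fin n → ℝ) → Set
IsEstimate α d A = ∀ i j → d i j ≤ᴿ A i j × A i j ≤ᴿ α *ᴿ d i j

Bits : ℕ → Set
Bits b = Vec Bool b

-- The oracle writes distances into a register of b qubits.  A number
-- format says which real number each b-bit string stands for; every
-- finite metric space has its distances among the values of some format.
record Format (b : ℕ) : Set where
  field
    value     : Bits b → ℝ
    injective : ∀ u v → value u ≈ᴿ value v → u ≡ v

open Format public

-- Computational basis ∣ i , j , z , w ⟩: a query pair (i , j), the oracle's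
-- answer register z, and a workspace of dimension s.
Basis : ℕ → ℕ → ℕ → Set
Basis n b s = Fin n × Fin n × Bits b × Fin s

allBits : ∀ b → List (Bits b)
allBits zero    = Vec.[] ∷ []
allBits (suc b) = map (λ (c , v) → c Vec.∷ v)
                      (cartesianProduct (false ∷ true ∷ []) (allBits b))

basis : ∀ n b s → List (Basis n b s)
basis n b s = cartesianProduct (allFin n)
  (cartesianProduct (allFin n) (cartesianProduct (allBits b) (allFin s)))

_≟ᴮ_ : ∀ {n b s} → DecidableEquality (Basis n b s)
_≟ᴮ_ = ×-≡-dec Fin._≟_ (×-≡-dec Fin._≟_ (×-≡-dec (Vec-≡-dec Bool._≟_) Fin._≟_))

State Matrix : ℕ → ℕ → ℕ → Set
State  n b s = Basis n b s → ℂ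
Matrix n b s = Basis n b s → Basis n b s → ℂ

module _ {n b s : ℕ} where

  ∑ᴿ : (Basis n b s → ℝ) → ℝ
  ∑ᴿ f = foldr (λ e t → f e +ᴿ t) 0ᴿ (basis n b s)

  ∑ᶜ : (Basis n b s → ℂ) → ℂ
  ∑ᶜ f = foldr (λ e t → f e +ᶜ t) 0ᶜ (basis n b s)

  δ : Basis n b s → Basis n b s → ℂ
  δ e f = if does (e ≟ᴮ f) then 1ᶜ else 0ᶜ

  IsUnitary : Matrix n b s → Set
  IsUnitary U =
    (∀ e f → ∑ᶜ (λ g → conj (U g e) *ᶜ U g f) ≈ᶜ δ e f) ×
    (∀ e f → ∑ᶜ (λ g → U e g *ᶜ conj (U f g)) ≈ᶜ δ e f)

  apply : Matrix n b s → State n b s → State n b s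
  apply U ψ e = ∑ᶜ λ f → U e f *ᶜ ψ f

  -- The oracle ∣ i , j , z , w ⟩ ↦ ∣ i , j , z ⊕ x i j , w ⟩.  It is its own
  -- inverse, so the same formula gives its action on amplitudes.
  query : (Fin n → Fin n → Bits b) → State n b s → State n b s
  query x ψ (i , j , z , w) = ψ (i , j , Vec.zipWith _xor_ z (x i j) , w)

record Unitary (n b s : ℕ) : Set where
  field
    matrix    : Matrix n b s
    isUnitary : IsUnitary matrix

open Unitary public

-- A T-query circuit on n points: U_T O U_{T-1} O … O U₀ applied to a basis
-- state, followed by a measurement in the computational basis whose
-- outcome determines the output matrix.
record Circuit (n b T : ℕ) : Set where
  field
    workspace : ℕ
    start     : Basis n b workspace
    U₀        : Unitary n b workspace
    Us        : Vec (Unitary n b workspace) T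
    output    : Basis n b workspace → Fin n → Fin n → ℝ

  finalState : (Fin n → Fin n → Bits b) → State n b workspace
  finalState x =
    Vec.foldl′ (λ ψ U → apply (matrix U) (query x ψ)) (apply (matrix U₀) (δ start)) Us

-- "With probability at least 2/3 the output is correct".  Inequality of
-- reals is not decidable, so the event is given through a decidable set S
-- of outcomes, all correct, of total probability at least 2/3; classically
-- S can be taken to be the set of all correct outcomes.
Succeeds : ∀ {n b T} → ℝ → Circuit n b T → (Fin n → Fin n → ℝ) →
           (Fin n → Fin n → Bits b) → Set
Succeeds α C d x =
  Σ[ S ∈ (Basis _ _ workspace → Bool) ]
    (∀ e → S e ≡ true → IsEstimate α d (output e)) ×
    fromℚ (+ 2 / 3) ≤ᴿ ∑ᴿ (λ e → if S e then ∣ finalState x e ∣² else 0ᴿ)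
  where open Circuit C

-- The circuit may depend on the number format, but its number of queries
-- is a function of n only.
Algorithm : ℕ → ℕ → Set
Algorithm n T = ∀ {b} → Format b → Circuit n b T

-- Here x is the oracle's table of encoded distances.
SolvesMetricEstimation : ∀ {n T} → ℝ → Algorithm n T → Set
SolvesMetricEstimation {n} α A =
  ∀ {b} (F : Format b) (d : Fin n → Fin n → ℝ) (x : Fin n → Fin n → Bits b) →
  IsMetric d → (∀ i j → value F (x i j) ≈ᴿ d i j) → Succeeds α (A F) d x

{-# OPTIONS --safe #-}
-- Split the points into two halves of sizes h and m; points of the same half
-- are at distance 2, and each of the N = h m cross distances is 1 or 3
-- according to a hidden bit.  Every choice of bits gives a metric, and an
-- estimate with factor less than 3 reveals all bits.  By the polynomial
-- method the amplitudes after T queries have degree at most T in the hidden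
-- bits, so the expected sign Q(x) of the string read off the output has
-- degree at most 2T.  If 2T < N then Q is uncorrelated with sign, that is,
-- with parity.  But sign x * Q(x) is at least twice the success probability
-- minus the total probability, hence at least 1/3.
--
-- Everything except unitarity is an exact identity between rationals at each
-- index of the Cauchy sequences; limits enter only through the total
-- probability and the final estimate at one large index.
module Submission where

open import Defs
open import Algebra.Bundles using (CommutativeSemiring)
open import Algebra.Structures.Biased using (isCommutativeSemiringˡ)
open import Data.Bool using (Bool; true; false; _xor_; if_then_else_)
open import Data.Fin using (Fin; zero; suc; splitAt; join; combine; remQuot; _↑ˡ_; _↑ʳ_)
import Data.Fin.Properties as Fin
open import Data.Integer using (+_; +≤+)
open import Data.List using (List; []; _∷_; _++_; foldr; map; cartesianProduct; allFin)
open import Data.List.Membership.Propositional using (_∈_)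
open import Data.List.Membership.Propositional.Properties using (∈-allFin; ∈-cartesianProduct⁺; ∈-map⁺)
open import Data.List.Relation.Unary.All as All using (All; []; _∷_)
open import Data.List.Relation.Unary.AllPairs using ([]; _∷_)
open import Data.List.Relation.Unary.Any using (here; there)
open import Data.List.Relation.Unary.Unique.Propositional using (Unique)
open import Data.List.Relation.Unary.Unique.Propositional.Properties using (allFin⁺; cartesianProduct⁺; map⁺)
open import Data.Nat as ℕ using (ℕ; zero; suc; s≤s)
import Data.Nat.Properties as ℕ
import Data.Nat.Solver
open import Data.Product using (∃-syntax; _×_; _,_; proj₁; proj₂)
open import Data.Rational as ℚ using (ℚ; 0ℚ; 1ℚ; ½; Positive; _/_; 1/_; ∣_∣)
import Data.Rational.Properties as ℚ
open import Data.Rational.Solver using (module +-*-Solver)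
open import Data.Sum using (_⊎_; inj₁; inj₂)
open import Data.Unit using (⊤; tt)
open import Data.Vec as Vec using (Vec; []; _∷_; lookup; tabulate)
open import Data.Vec.Properties using (tabulate-cong; tabulate∘lookup)
open import Function using (_∘_)
open import Level using (Level; 0ℓ)
open import Relation.Binary.Definitions using (DecidableEquality)
open import Relation.Binary.PropositionalEquality as ≡ using (_≡_; _≢_; refl; sym; trans; cong; cong₂; subst)
open import Relation.Binary.Structures using (IsEquivalence; IsPartialOrder)
open import Relation.Nullary using (contradiction; ¬_)
open import Relation.Nullary.Decidable using (does; yes; no; dec-true; dec-false)

-- Real and complex numbers up to convergence

Eventually : (ℕ → Set) → Set
Eventually P = ∃[ N ] ∀ n → N ℕ.≤ n → P n

always : ∀ {P} → (∀ n → P n) → Eventually P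
always p = 0 , λ n _ → p n

eventually-map : ∀ {P Q} → (∀ n → P n → Q n) → Eventually P → Eventually Q
eventually-map f (N , p) = N , λ n N≤n → f n (p n N≤n)

eventually-zip : ∀ {P Q R} → (∀ n → P n → Q n → R n) →
  Eventually P → Eventually Q → Eventually R
eventually-zip f (M , p) (N , q) = M ℕ.⊔ N , λ n M⊔N≤n →
  f n (p n (ℕ.m⊔n≤o⇒m≤o M N M⊔N≤n)) (q n (ℕ.m⊔n≤o⇒n≤o M N M⊔N≤n))

eventually-at : ∀ {P} → Eventually P → ∃[ n ] P n
eventually-at (N , p) = N , p N ℕ.≤-refl

-- Linear arithmetic by certificate: `a ≤ b` is a sum of the available inequalities, and the ring
-- solver confirms that the goal has the same gap between its two sides.
≤-shift : ∀ {a b c d} → a ℚ.≤ b → d ℚ.- c ≡ b ℚ.- a → c ℚ.≤ d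
≤-shift {a} {b} {c} {d} a≤b eq = begin
  c                        ≡⟨ solve 2 (λ a c → c := a :+ (c :- a)) refl a c ⟩
  a ℚ.+ (c ℚ.- a)          ≤⟨ ℚ.+-monoˡ-≤ (c ℚ.- a) a≤b ⟩
  b ℚ.+ (c ℚ.- a)          ≡⟨ solve 3 (λ a b c → b :+ (c :- a) := (b :- a) :+ c) refl a b c ⟩
  (b ℚ.- a) ℚ.+ c          ≡⟨ cong (ℚ._+ c) (sym eq) ⟩
  (d ℚ.- c) ℚ.+ c          ≡⟨ solve 2 (λ c d → (d :- c) :+ c := d) refl c d ⟩
  d                        ∎
  where open ℚ.≤-Reasoning
        open +-*-Solver

<-shift : ∀ {a b c d} → a ℚ.< b → d ℚ.- c ≡ b ℚ.- a → c ℚ.< d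
<-shift {a} {b} {c} {d} a<b eq = begin-strict
  c                        ≡⟨ solve 2 (λ a c → c := a :+ (c :- a)) refl a c ⟩
  a ℚ.+ (c ℚ.- a)          <⟨ ℚ.+-monoˡ-< (c ℚ.- a) a<b ⟩
  b ℚ.+ (c ℚ.- a)          ≡⟨ solve 3 (λ a b c → b :+ (c :- a) := (b :- a) :+ c) refl a b c ⟩
  (b ℚ.- a) ℚ.+ c          ≡⟨ cong (ℚ._+ c) (sym eq) ⟩
  (d ℚ.- c) ℚ.+ c          ≡⟨ solve 2 (λ c d → (d :- c) :+ c := d) refl c d ⟩
  d                        ∎
  where open ℚ.≤-Reasoning
        open +-*-Solver

p≤∣p∣ : ∀ p → p ℚ.≤ ∣ p ∣
p≤∣p∣ p with ℚ.≤-total 0ℚ p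
... | inj₁ 0≤p = ℚ.≤-reflexive (sym (ℚ.0≤p⇒∣p∣≡p 0≤p))
... | inj₂ p≤0 = ℚ.≤-trans p≤0 (ℚ.0≤∣p∣ p)

∣-∣-least : ∀ {p q} → p ℚ.≤ q → ℚ.- p ℚ.≤ q → ∣ p ∣ ℚ.≤ q
∣-∣-least {p} p≤q -p≤q with ℚ.∣p∣≡p∨∣p∣≡-p p
... | inj₁ eq = subst (ℚ._≤ _) (sym eq) p≤q
... | inj₂ eq = subst (ℚ._≤ _) (sym eq) -p≤q

∣-∣-swap : ∀ p q → ∣ p ℚ.- q ∣ ≡ ∣ q ℚ.- p ∣
∣-∣-swap p q = trans (sym (ℚ.∣-p∣≡∣p∣ (p ℚ.- q)))
  (cong ∣_∣ (solve 2 (λ p q → :- (p :- q) := q :- p) refl p q))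
  where open +-*-Solver

half : ℚ → ℚ
half ε = ½ ℚ.* ε

half-pos : ∀ {ε} → 0ℚ ℚ.< ε → 0ℚ ℚ.< half ε
half-pos {ε} 0<ε = subst (ℚ._< half ε) (ℚ.*-zeroʳ ½) (ℚ.*-monoʳ-<-pos ½ {0ℚ} {ε} 0<ε)

half+half : ∀ ε → half ε ℚ.+ half ε ≡ ε
half+half ε = trans (sym (ℚ.*-distribʳ-+ ε ½ ½)) (ℚ.*-identityˡ ε)

half-< : ∀ {ε} → 0ℚ ℚ.< ε → half ε ℚ.< ε
half-< {ε} 0<ε = begin-strict
  half ε               ≡⟨ ℚ.+-identityʳ (half ε) ⟨
  half ε ℚ.+ 0ℚ        <⟨ ℚ.+-monoʳ-< (half ε) (half-pos 0<ε) ⟩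
  half ε ℚ.+ half ε    ≡⟨ half+half ε ⟩
  ε                    ∎
  where open ℚ.≤-Reasoning

-- `x ≈ᴿ y` unfolds to `Null` of the termwise difference, so every congruence below reduces to
-- closure properties of null sequences.
Null : (ℕ → ℚ) → Set
Null u = ∀ ε → 0ℚ ℚ.< ε → Eventually (λ n → ∣ u n ∣ ℚ.< ε)

null-resp : ∀ {u v} → (∀ n → u n ≡ v n) → Null u → Null v
null-resp eq Nu ε 0<ε = eventually-map (λ n → subst (λ p → ∣ p ∣ ℚ.< ε) (eq n)) (Nu ε 0<ε)

null-+ : ∀ {u v} → Null u → Null v → Null (λ n → u n ℚ.+ v n)
null-+ {u} {v} Nu Nv ε 0<ε =
  eventually-zip add (Nu (half ε) (half-pos 0<ε)) (Nv (half ε) (half-pos 0<ε))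
  where
  open ℚ.≤-Reasoning
  add : ∀ n → ∣ u n ∣ ℚ.< half ε → ∣ v n ∣ ℚ.< half ε → ∣ u n ℚ.+ v n ∣ ℚ.< ε
  add n u< v< = begin-strict
    ∣ u n ℚ.+ v n ∣      ≤⟨ ℚ.∣p+q∣≤∣p∣+∣q∣ (u n) (v n) ⟩
    ∣ u n ∣ ℚ.+ ∣ v n ∣  <⟨ ℚ.+-mono-< u< v< ⟩
    half ε ℚ.+ half ε    ≡⟨ half+half ε ⟩
    ε                    ∎

-- Beyond the index `N` where the terms of `x` stay within 1 of each other, `x` is bounded by `B`,
-- so it suffices that `u` drops below `ε / B`.
null-*ˡ : ∀ x {u} → Null u → Null (λ n → seq x n ℚ.* u n)
null-*ˡ x {u} Nu ε 0<ε with cauchy x 1ℚ (ℚ.positive⁻¹ 1ℚ)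
... | N , c = eventually-zip mul (N , λ n N≤n → c n N N≤n ℕ.≤-refl) (Nu η 0<η)
  where
  open ℚ.≤-Reasoning
  open +-*-Solver
  B = 1ℚ ℚ.+ ∣ seq x N ∣
  instance
    B>0 : Positive B
    B>0 = ℚ.positive (ℚ.+-mono-<-≤ (ℚ.positive⁻¹ 1ℚ) (ℚ.0≤∣p∣ (seq x N)))
    B≢0 : ℚ.NonZero B
    B≢0 = ℚ.pos⇒nonZero B
    B⁻¹>0 : Positive (1/ B)
    B⁻¹>0 = ℚ.1/pos⇒pos B
  η = 1/ B ℚ.* ε
  0<η : 0ℚ ℚ.< η
  0<η = subst (ℚ._< η) (ℚ.*-zeroʳ (1/ B)) (ℚ.*-monoʳ-<-pos (1/ B) {0ℚ} {ε} 0<ε)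
  bound : ∀ n → ∣ seq x n ℚ.- seq x N ∣ ℚ.< 1ℚ → ∣ seq x n ∣ ℚ.≤ B
  bound n lt = begin
    ∣ seq x n ∣                                    ≡⟨ cong ∣_∣ (solve 2 (λ a b → a := (a :- b) :+ b) refl (seq x n) (seq x N)) ⟩
    ∣ (seq x n ℚ.- seq x N) ℚ.+ seq x N ∣          ≤⟨ ℚ.∣p+q∣≤∣p∣+∣q∣ (seq x n ℚ.- seq x N) (seq x N) ⟩
    ∣ seq x n ℚ.- seq x N ∣ ℚ.+ ∣ seq x N ∣        ≤⟨ ℚ.+-monoˡ-≤ ∣ seq x N ∣ (ℚ.<⇒≤ lt) ⟩
    B                                              ∎
  mul : ∀ n → ∣ seq x n ℚ.- seq x N ∣ ℚ.< 1ℚ → ∣ u n ∣ ℚ.< η → ∣ seq x n ℚ.* u n ∣ ℚ.< ε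
  mul n close small = begin-strict
    ∣ seq x n ℚ.* u n ∣        ≡⟨ ℚ.∣p*q∣≡∣p∣*∣q∣ (seq x n) (u n) ⟩
    ∣ seq x n ∣ ℚ.* ∣ u n ∣    ≤⟨ ℚ.*-monoʳ-≤-nonNeg ∣ u n ∣ {{ℚ.∣-∣-nonNeg (u n)}} (bound n close) ⟩
    B ℚ.* ∣ u n ∣              <⟨ ℚ.*-monoʳ-<-pos B small ⟩
    B ℚ.* (1/ B ℚ.* ε)         ≡⟨ sym (ℚ.*-assoc B (1/ B) ε) ⟩
    B ℚ.* 1/ B ℚ.* ε           ≡⟨ cong (ℚ._* ε) (ℚ.*-inverseʳ B) ⟩
    1ℚ ℚ.* ε                   ≡⟨ ℚ.*-identityˡ ε ⟩
    ε                          ∎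

-- The operations act term by term on the sequences, so algebraic laws of real numbers come from
-- rational identities at each index through this lemma.
pointwise : ∀ {x y} → (∀ n → seq x n ≡ seq y n) → x ≈ᴿ y
pointwise {x} {y} eq ε 0<ε = always λ n →
  subst (λ p → ∣ p ∣ ℚ.< ε) (sym (trans (cong (ℚ._- seq y n) (eq n)) (ℚ.+-inverseʳ (seq y n)))) 0<ε

≈ᴿ-isEquivalence : IsEquivalence _≈ᴿ_
≈ᴿ-isEquivalence = record
  { refl  = λ {x} → pointwise {x} {x} (λ _ → refl)
  ; sym   = λ {x} {y} x≈y ε 0<ε → eventually-map
      (λ n → subst (ℚ._< ε) (∣-∣-swap (seq x n) (seq y n))) (x≈y ε 0<ε)
  ; trans = λ {x} {y} {z} x≈y y≈z → null-resp
      (λ n → solve 3 (λ a b c → (a :- b) :+ (b :- c) := a :- c) refl (seq x n) (seq y n) (seq z n))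
      (null-+ x≈y y≈z)
  }
  where open +-*-Solver

module ≈ᴿ = IsEquivalence ≈ᴿ-isEquivalence

+ᴿ-cong : ∀ {x x′ y y′} → x ≈ᴿ x′ → y ≈ᴿ y′ → x +ᴿ y ≈ᴿ x′ +ᴿ y′
+ᴿ-cong {x} {x′} {y} {y′} x≈x′ y≈y′ = null-resp
  (λ n → solve 4 (λ a b c d → (a :- b) :+ (c :- d) := (a :+ c) :- (b :+ d)) refl
    (seq x n) (seq x′ n) (seq y n) (seq y′ n))
  (null-+ x≈x′ y≈y′)
  where open +-*-Solver

-ᴿ-cong : ∀ {x x′} → x ≈ᴿ x′ → -ᴿ x ≈ᴿ -ᴿ x′
-ᴿ-cong {x} {x′} x≈x′ = null-resp
  (λ n → solve 2 (λ a b → b :- a := (:- a) :- (:- b)) refl (seq x n) (seq x′ n))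
  (≈ᴿ.sym {x} {x′} x≈x′)
  where open +-*-Solver

*ᴿ-cong : ∀ {x x′ y y′} → x ≈ᴿ x′ → y ≈ᴿ y′ → x *ᴿ y ≈ᴿ x′ *ᴿ y′
*ᴿ-cong {x} {x′} {y} {y′} x≈x′ y≈y′ = null-resp
  (λ n → solve 4 (λ a b c d → a :* (c :- d) :+ d :* (a :- b) := a :* c :- b :* d) refl
    (seq x n) (seq x′ n) (seq y n) (seq y′ n))
  (null-+ (null-*ˡ x y≈y′) (null-*ˡ y′ x≈x′))
  where open +-*-Solver

pointwiseᶜ : ∀ {z w} → (∀ n → seq (re z) n ≡ seq (re w) n) →
  (∀ n → seq (im z) n ≡ seq (im w) n) → z ≈ᶜ w
pointwiseᶜ {z} {w} eq₁ eq₂ = pointwise {re z} {re w} eq₁ , pointwise {im z} {im w} eq₂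

ℂ-commutativeSemiring : CommutativeSemiring 0ℓ 0ℓ
ℂ-commutativeSemiring = record
  { Carrier = ℂ ; _≈_ = _≈ᶜ_ ; _+_ = _+ᶜ_ ; _*_ = _*ᶜ_ ; 0# = 0ᶜ ; 1# = 1ᶜ
  ; isCommutativeSemiring = isCommutativeSemiringˡ record
    { +-isCommutativeMonoid = record
      { isMonoid = record
        { isSemigroup = record
          { isMagma = record
            { isEquivalence = ≈ᶜ-isEquivalence
            ; ∙-cong = λ {z} {z′} {w} {w′} z≈ w≈ →
                +ᴿ-cong {re z} {re z′} {re w} {re w′} (proj₁ z≈) (proj₁ w≈) ,
                +ᴿ-cong {im z} {im z′} {im w} {im w′} (proj₂ z≈) (proj₂ w≈)
            }
          ; assoc = λ z w u → pointwiseᶜ {(z +ᶜ w) +ᶜ u} {z +ᶜ (w +ᶜ u)}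
              (λ n → ℚ.+-assoc (seq (re z) n) (seq (re w) n) (seq (re u) n))
              (λ n → ℚ.+-assoc (seq (im z) n) (seq (im w) n) (seq (im u) n))
          }
        ; identity =
            (λ z → pointwiseᶜ {0ᶜ +ᶜ z} {z}
              (λ n → ℚ.+-identityˡ (seq (re z) n)) (λ n → ℚ.+-identityˡ (seq (im z) n))) ,
            (λ z → pointwiseᶜ {z +ᶜ 0ᶜ} {z}
              (λ n → ℚ.+-identityʳ (seq (re z) n)) (λ n → ℚ.+-identityʳ (seq (im z) n)))
        }
      ; comm = λ z w → pointwiseᶜ {z +ᶜ w} {w +ᶜ z}
          (λ n → ℚ.+-comm (seq (re z) n) (seq (re w) n))
          (λ n → ℚ.+-comm (seq (im z) n) (seq (im w) n))
      }
    ; *-isCommutativeMonoid = record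
      { isMonoid = record
        { isSemigroup = record
          { isMagma = record
            { isEquivalence = ≈ᶜ-isEquivalence
            ; ∙-cong = λ {z} {z′} {w} {w′} → *ᶜ-cong {z} {z′} {w} {w′}
            }
          ; assoc = λ z w u → pointwiseᶜ {(z *ᶜ w) *ᶜ u} {z *ᶜ (w *ᶜ u)}
              (λ n → solve 6 (λ a b c d e f →
                  proj₁ (((a , b) ⊗ (c , d)) ⊗ (e , f)) := proj₁ ((a , b) ⊗ ((c , d) ⊗ (e , f)))) refl
                (seq (re z) n) (seq (im z) n) (seq (re w) n) (seq (im w) n) (seq (re u) n) (seq (im u) n))
              (λ n → solve 6 (λ a b c d e f →
                  proj₂ (((a , b) ⊗ (c , d)) ⊗ (e , f)) := proj₂ ((a , b) ⊗ ((c , d) ⊗ (e , f)))) refl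
                (seq (re z) n) (seq (im z) n) (seq (re w) n) (seq (im w) n) (seq (re u) n) (seq (im u) n))
          }
        ; identity = (λ z → *ᶜ-identityˡ z) ,
            (λ z → ≈ᶜ.trans {z *ᶜ 1ᶜ} {1ᶜ *ᶜ z} {z} (*ᶜ-comm z 1ᶜ) (*ᶜ-identityˡ z))
        }
      ; comm = *ᶜ-comm
      }
    ; distribʳ = λ u z w → pointwiseᶜ {(z +ᶜ w) *ᶜ u} {z *ᶜ u +ᶜ w *ᶜ u}
        (λ n → solve 6 (λ a b c d e f →
            proj₁ ((a :+ c , b :+ d) ⊗ (e , f)) := proj₁ ((a , b) ⊗ (e , f)) :+ proj₁ ((c , d) ⊗ (e , f))) refl
          (seq (re z) n) (seq (im z) n) (seq (re w) n) (seq (im w) n) (seq (re u) n) (seq (im u) n))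
        (λ n → solve 6 (λ a b c d e f →
            proj₂ ((a :+ c , b :+ d) ⊗ (e , f)) := proj₂ ((a , b) ⊗ (e , f)) :+ proj₂ ((c , d) ⊗ (e , f))) refl
          (seq (re z) n) (seq (im z) n) (seq (re w) n) (seq (im w) n) (seq (re u) n) (seq (im u) n))
    ; zeroˡ = λ z → pointwiseᶜ {0ᶜ *ᶜ z} {0ᶜ}
        (λ n → solve 2 (λ a b → proj₁ ((con 0ℚ , con 0ℚ) ⊗ (a , b)) := con 0ℚ) refl (seq (re z) n) (seq (im z) n))
        (λ n → solve 2 (λ a b → proj₂ ((con 0ℚ , con 0ℚ) ⊗ (a , b)) := con 0ℚ) refl (seq (re z) n) (seq (im z) n))
    }
  }
  where
  open +-*-Solver
  -- Complex multiplication on pairs of solver polynomials: it generates the real and imaginary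
  -- parts of each law instead of having them written out.
  _⊗_ : ∀ {k} → Polynomial k × Polynomial k → Polynomial k × Polynomial k → Polynomial k × Polynomial k
  (a , b) ⊗ (c , d) = (a :* c :- b :* d) , (a :* d :+ b :* c)

  ≈ᶜ-isEquivalence : IsEquivalence _≈ᶜ_
  ≈ᶜ-isEquivalence = record
    { refl  = λ {z} → ≈ᴿ.refl {re z} , ≈ᴿ.refl {im z}
    ; sym   = λ {z} {w} (p , q) → ≈ᴿ.sym {re z} {re w} p , ≈ᴿ.sym {im z} {im w} q
    ; trans = λ {z} {w} {u} (p , q) (r , s) →
        ≈ᴿ.trans {re z} {re w} {re u} p r , ≈ᴿ.trans {im z} {im w} {im u} q s
    }
  module ≈ᶜ = IsEquivalence ≈ᶜ-isEquivalence

  *ᶜ-cong : ∀ {z z′ w w′} → z ≈ᶜ z′ → w ≈ᶜ w′ → z *ᶜ w ≈ᶜ z′ *ᶜ w′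
  *ᶜ-cong {a +i b} {a′ +i b′} {c +i d} {c′ +i d′} (a≈ , b≈) (c≈ , d≈) =
    +ᴿ-cong {a *ᴿ c} {a′ *ᴿ c′} { -ᴿ (b *ᴿ d)} { -ᴿ (b′ *ᴿ d′)}
      (*ᴿ-cong {a} {a′} {c} {c′} a≈ c≈)
      (-ᴿ-cong {b *ᴿ d} {b′ *ᴿ d′} (*ᴿ-cong {b} {b′} {d} {d′} b≈ d≈)) ,
    +ᴿ-cong {a *ᴿ d} {a′ *ᴿ d′} {b *ᴿ c} {b′ *ᴿ c′}
      (*ᴿ-cong {a} {a′} {d} {d′} a≈ d≈) (*ᴿ-cong {b} {b′} {c} {c′} b≈ c≈)

  *ᶜ-comm : ∀ z w → z *ᶜ w ≈ᶜ w *ᶜ z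
  *ᶜ-comm z w = pointwiseᶜ {z *ᶜ w} {w *ᶜ z}
    (λ n → solve 4 (λ a b c d → proj₁ ((a , b) ⊗ (c , d)) := proj₁ ((c , d) ⊗ (a , b))) refl
      (seq (re z) n) (seq (im z) n) (seq (re w) n) (seq (im w) n))
    (λ n → solve 4 (λ a b c d → proj₂ ((a , b) ⊗ (c , d)) := proj₂ ((c , d) ⊗ (a , b))) refl
      (seq (re z) n) (seq (im z) n) (seq (re w) n) (seq (im w) n))

  *ᶜ-identityˡ : ∀ z → 1ᶜ *ᶜ z ≈ᶜ z
  *ᶜ-identityˡ z = pointwiseᶜ {1ᶜ *ᶜ z} {z}
    (λ n → solve 2 (λ a b → proj₁ ((con 1ℚ , con 0ℚ) ⊗ (a , b)) := a) refl (seq (re z) n) (seq (im z) n))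
    (λ n → solve 2 (λ a b → proj₂ ((con 1ℚ , con 0ℚ) ⊗ (a , b)) := b) refl (seq (re z) n) (seq (im z) n))

-- Finite sums and the norm

module ListSum {c ℓ} (R : CommutativeSemiring c ℓ) where
  open CommutativeSemiring R renaming (refl to ≈-refl; sym to ≈-sym; trans to ≈-trans)
  open import Relation.Binary.Reasoning.Setoid setoid
  open import Algebra.Properties.CommutativeSemigroup +-commutativeSemigroup using (interchange)

  private variable
    a b : Level
    A : Set a
    B : Set b

  -- Folds exactly as `∑ᶜ` does, so over `basis n b s` the two agree definitionally.
  Σ : List A → (A → Carrier) → Carrier
  Σ xs f = foldr (λ e t → f e + t) 0# xs

  Σ-cong : ∀ (xs : List A) {f g} → (∀ e → f e ≈ g e) → Σ xs f ≈ Σ xs g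
  Σ-cong []       f≈g = ≈-refl
  Σ-cong (x ∷ xs) f≈g = +-cong (f≈g x) (Σ-cong xs f≈g)

  Σ-0 : ∀ (xs : List A) → Σ xs (λ _ → 0#) ≈ 0#
  Σ-0 []       = ≈-refl
  Σ-0 (x ∷ xs) = ≈-trans (+-identityˡ _) (Σ-0 xs)

  Σ-+ : ∀ (xs : List A) f g → Σ xs (λ e → f e + g e) ≈ Σ xs f + Σ xs g
  Σ-+ []       f g = ≈-sym (+-identityˡ 0#)
  Σ-+ (x ∷ xs) f g = ≈-trans (+-congˡ (Σ-+ xs f g)) (interchange (f x) (g x) (Σ xs f) (Σ xs g))

  Σ-swap : ∀ (xs : List A) (ys : List B) (f : A → B → Carrier) →
    Σ xs (λ x → Σ ys (λ y → f x y)) ≈ Σ ys (λ y → Σ xs (λ x → f x y))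
  Σ-swap []       ys f = ≈-sym (Σ-0 ys)
  Σ-swap (x ∷ xs) ys f = ≈-trans (+-congˡ (Σ-swap xs ys f)) (≈-sym (Σ-+ ys (f x) _))

  *-Σ : ∀ (xs : List A) c f → c * Σ xs f ≈ Σ xs (λ e → c * f e)
  *-Σ []       c f = zeroʳ c
  *-Σ (x ∷ xs) c f = ≈-trans (distribˡ c (f x) (Σ xs f)) (+-congˡ (*-Σ xs c f))

  Σ-*-Σ : ∀ (xs : List A) (ys : List B) f g →
    Σ xs f * Σ ys g ≈ Σ xs (λ x → Σ ys (λ y → f x * g y))
  Σ-*-Σ xs ys f g = begin
    Σ xs f * Σ ys g                      ≈⟨ *-comm _ _ ⟩
    Σ ys g * Σ xs f                      ≈⟨ *-Σ xs (Σ ys g) f ⟩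
    Σ xs (λ x → Σ ys g * f x)            ≈⟨ Σ-cong xs (λ x → ≈-trans (*-comm _ _) (*-Σ ys (f x) g)) ⟩
    Σ xs (λ x → Σ ys (λ y → f x * g y))  ∎

  Σ-++ : ∀ (xs ys : List A) f → Σ (xs ++ ys) f ≈ Σ xs f + Σ ys f
  Σ-++ []       ys f = ≈-sym (+-identityˡ _)
  Σ-++ (x ∷ xs) ys f = ≈-trans (+-congˡ (Σ-++ xs ys f)) (≈-sym (+-assoc _ _ _))

  Σ-map : ∀ (h : A → B) xs f → Σ (map h xs) f ≈ Σ xs (f ∘ h)
  Σ-map h []       f = ≈-refl
  Σ-map h (x ∷ xs) f = +-congˡ (Σ-map h xs f)

  Σ-cartesianProduct : ∀ (xs : List A) (ys : List B) f →
    Σ (cartesianProduct xs ys) f ≈ Σ xs (λ x → Σ ys (λ y → f (x , y)))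
  Σ-cartesianProduct []       ys f = ≈-refl
  Σ-cartesianProduct (x ∷ xs) ys f = ≈-trans
    (Σ-++ (map (x ,_) ys) (cartesianProduct xs ys) f)
    (+-cong (Σ-map (x ,_) ys f) (Σ-cartesianProduct xs ys f))

  module _ (_≟_ : DecidableEquality A) where

    indicator : A → A → Carrier
    indicator x y = if does (x ≟ y) then 1# else 0#

    Σ-indicator-∉ : ∀ {x xs} (f : A → Carrier) → All (x ≢_) xs → Σ xs (λ y → f y * indicator x y) ≈ 0#
    Σ-indicator-∉ f []         = ≈-refl
    Σ-indicator-∉ {x} f (_∷_ {y} x≢y ps) with x ≟ y
    ... | yes x≡y = contradiction x≡y x≢y
    ... | no  _   = ≈-trans (+-cong (zeroʳ (f y)) (Σ-indicator-∉ f ps)) (+-identityˡ 0#)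

    -- The sifting property of the Kronecker delta: membership supplies one occurrence of `x`, and
    -- uniqueness makes all the other terms vanish.
    Σ-indicator : ∀ {x xs} (f : A → Carrier) → Unique xs → x ∈ xs → Σ xs (λ y → f y * indicator x y) ≈ f x
    Σ-indicator {x} f (x∉xs ∷ u) (here refl) with x ≟ x
    ... | yes _   = ≈-trans (+-cong (*-identityʳ (f x)) (Σ-indicator-∉ f x∉xs)) (+-identityʳ (f x))
    ... | no  x≢x = contradiction refl x≢x
    Σ-indicator {x} f (_∷_ {y} y∉xs u) (there x∈xs) with x ≟ y
    ... | yes refl = contradiction refl (All.lookup y∉xs x∈xs)
    ... | no  _      = ≈-trans (+-cong (zeroʳ (f y)) (Σ-indicator f u x∈xs)) (+-identityˡ (f x))

  Σ-allBits-suc : ∀ b f →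
    Σ (allBits (suc b)) f ≈ Σ (allBits b) (f ∘ (false ∷_)) + Σ (allBits b) (f ∘ (true ∷_))
  Σ-allBits-suc b f = begin
    Σ (allBits (suc b)) f
      ≈⟨ Σ-map (λ (c , v) → c Vec.∷ v) (cartesianProduct (false ∷ true ∷ []) (allBits b)) f ⟩
    Σ (cartesianProduct (false ∷ true ∷ []) (allBits b)) _
      ≈⟨ Σ-cartesianProduct (false ∷ true ∷ []) (allBits b) _ ⟩
    Σ (allBits b) (f ∘ (false ∷_)) + (Σ (allBits b) (f ∘ (true ∷_)) + 0#)
      ≈⟨ +-congˡ (+-identityʳ _) ⟩
    Σ (allBits b) (f ∘ (false ∷_)) + Σ (allBits b) (f ∘ (true ∷_)) ∎

  -- XOR with a fixed string permutes the strings. In the induction, a leading `false` keeps the two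
  -- halves of the sum in place and a leading `true` exchanges them.
  Σ-allBits-xor : ∀ b (y : Bits b) f →
    Σ (allBits b) (λ z → f (Vec.zipWith _xor_ z y)) ≈ Σ (allBits b) f
  Σ-allBits-xor zero    []          f = ≈-refl
  Σ-allBits-xor (suc b) (false ∷ y) f = begin
    Σ (allBits (suc b)) (λ z → f (Vec.zipWith _xor_ z (false ∷ y)))  ≈⟨ Σ-allBits-suc b _ ⟩
    _ + _  ≈⟨ +-cong (Σ-allBits-xor b y (f ∘ (false ∷_))) (Σ-allBits-xor b y (f ∘ (true ∷_))) ⟩
    _ + _  ≈⟨ Σ-allBits-suc b f ⟨
    Σ (allBits (suc b)) f ∎
  Σ-allBits-xor (suc b) (true ∷ y)  f = begin
    Σ (allBits (suc b)) (λ z → f (Vec.zipWith _xor_ z (true ∷ y)))  ≈⟨ Σ-allBits-suc b _ ⟩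
    _ + _  ≈⟨ +-cong (Σ-allBits-xor b y (f ∘ (true ∷_))) (Σ-allBits-xor b y (f ∘ (false ∷_))) ⟩
    _ + _  ≈⟨ +-comm _ _ ⟩
    _ + _  ≈⟨ Σ-allBits-suc b f ⟨
    Σ (allBits (suc b)) f ∎

  -- The oracle permutes the computational basis: for fixed `i` and `j` it translates the answer
  -- register by `x i j`. Writing the sum as an iterated one isolates that register.
  Σ-basis-xor : ∀ {n b s} (x : Fin n → Fin n → Bits b) f →
    Σ (basis n b s) (λ (i , j , z , w) → f (i , j , Vec.zipWith _xor_ z (x i j) , w)) ≈
    Σ (basis n b s) f
  Σ-basis-xor {n} {b} {s} x f = begin
    Σ (basis n b s) (λ (i , j , z , w) → f (i , j , Vec.zipWith _xor_ z (x i j) , w))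
      ≈⟨ iterated _ ⟩
    Σ (allFin n) (λ i → Σ (allFin n) λ j → Σ (allBits b) λ z → Σ (allFin s) λ w →
      f (i , j , Vec.zipWith _xor_ z (x i j) , w))
      ≈⟨ Σ-cong (allFin n) (λ i → Σ-cong (allFin n) λ j →
           Σ-allBits-xor b (x i j) (λ z → Σ (allFin s) λ w → f (i , j , z , w))) ⟩
    Σ (allFin n) (λ i → Σ (allFin n) λ j → Σ (allBits b) λ z → Σ (allFin s) λ w → f (i , j , z , w))
      ≈⟨ iterated f ⟨
    Σ (basis n b s) f ∎
    where
    iterated : ∀ f → Σ (basis n b s) f ≈
      Σ (allFin n) (λ i → Σ (allFin n) λ j → Σ (allBits b) λ z → Σ (allFin s) λ w → f (i , j , z , w))
    iterated f = ≈-trans (Σ-cartesianProduct (allFin n) _ f) (Σ-cong (allFin n) λ i →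
      ≈-trans (Σ-cartesianProduct (allFin n) _ _) (Σ-cong (allFin n) λ j →
        Σ-cartesianProduct (allBits b) (allFin s) _))

  module Norm (_⋆ : Carrier → Carrier)
    (⋆-0 : 0# ⋆ ≈ 0#)
    (⋆-1 : 1# ⋆ ≈ 1#)
    (⋆-+ : ∀ z w → (z + w) ⋆ ≈ z ⋆ + w ⋆)
    (⋆-* : ∀ z w → (z * w) ⋆ ≈ z ⋆ * w ⋆)
    {A : Set} (_≟_ : DecidableEquality A)
    {xs : List A} (xs-unique : Unique xs) (∈-xs : ∀ e → e ∈ xs)
    where
    open import Algebra.Properties.CommutativeSemigroup *-commutativeSemigroup
      using () renaming (interchange to *-interchange)

    ⋆-Σ : ∀ (ys : List A) f → Σ ys f ⋆ ≈ Σ ys (λ e → f e ⋆)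
    ⋆-Σ []       f = ⋆-0
    ⋆-Σ (x ∷ ys) f = ≈-trans (⋆-+ (f x) (Σ ys f)) (+-congˡ (⋆-Σ ys f))

    norm : (A → Carrier) → Carrier
    norm ψ = Σ xs (λ e → ψ e ⋆ * ψ e)

    norm-indicator : ∀ s → norm (indicator _≟_ s) ≈ 1#
    norm-indicator s = ≈-trans (Σ-indicator _≟_ (λ e → indicator _≟_ s e ⋆) xs-unique (∈-xs s)) diagonal
      where
      diagonal : indicator _≟_ s s ⋆ ≈ 1#
      diagonal with s ≟ s
      ... | yes _   = ⋆-1
      ... | no  s≢s = contradiction refl s≢s

    -- The squared norm of the image expands into a triple sum. Moving the sum over the row index
    -- `e` innermost produces the entries of the conjugate transpose times `U`, and the resulting
    -- delta collapses one of the two remaining sums.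
    norm-isometry : ∀ (U : A → A → Carrier) ψ →
      (∀ e f → Σ xs (λ g → U g e ⋆ * U g f) ≈ indicator _≟_ e f) →
      norm (λ e → Σ xs λ f → U e f * ψ f) ≈ norm ψ
    norm-isometry U ψ U-isometry = begin
      Σ xs (λ e → Σ xs (λ f → U e f * ψ f) ⋆ * Σ xs (λ g → U e g * ψ g))
        ≈⟨ Σ-cong xs (λ e → *-congʳ (≈-trans (⋆-Σ xs _) (Σ-cong xs λ f → ⋆-* (U e f) (ψ f)))) ⟩
      Σ xs (λ e → Σ xs (λ f → U e f ⋆ * ψ f ⋆) * Σ xs (λ g → U e g * ψ g))
        ≈⟨ Σ-cong xs (λ e → Σ-*-Σ xs xs _ _) ⟩
      Σ xs (λ e → Σ xs λ f → Σ xs λ g → (U e f ⋆ * ψ f ⋆) * (U e g * ψ g))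
        ≈⟨ Σ-cong xs (λ e → Σ-cong xs λ f → Σ-cong xs λ g →
             ≈-trans (*-interchange (U e f ⋆) (ψ f ⋆) (U e g) (ψ g)) (*-comm _ _)) ⟩
      Σ xs (λ e → Σ xs λ f → Σ xs λ g → (ψ f ⋆ * ψ g) * (U e f ⋆ * U e g))
        ≈⟨ Σ-swap xs xs _ ⟩
      Σ xs (λ f → Σ xs λ e → Σ xs λ g → (ψ f ⋆ * ψ g) * (U e f ⋆ * U e g))
        ≈⟨ Σ-cong xs (λ f → Σ-swap xs xs _) ⟩
      Σ xs (λ f → Σ xs λ g → Σ xs λ e → (ψ f ⋆ * ψ g) * (U e f ⋆ * U e g))
        ≈⟨ Σ-cong xs (λ f → Σ-cong xs λ g → *-Σ xs (ψ f ⋆ * ψ g) _) ⟨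
      Σ xs (λ f → Σ xs λ g → (ψ f ⋆ * ψ g) * Σ xs (λ e → U e f ⋆ * U e g))
        ≈⟨ Σ-cong xs (λ f → Σ-cong xs λ g → *-congˡ (U-isometry f g)) ⟩
      Σ xs (λ f → Σ xs λ g → (ψ f ⋆ * ψ g) * indicator _≟_ f g)
        ≈⟨ Σ-cong xs (λ f → Σ-indicator _≟_ (λ g → ψ f ⋆ * ψ g) xs-unique (∈-xs f)) ⟩
      Σ xs (λ f → ψ f ⋆ * ψ f) ∎

allBits-unique : ∀ b → Unique (allBits b)
allBits-unique zero    = [] ∷ []
allBits-unique (suc b) = map⁺ (λ { refl → refl })
  (cartesianProduct⁺ (((λ ()) ∷ []) ∷ [] ∷ []) (allBits-unique b))

∈-allBits : ∀ {b} (v : Bits b) → v ∈ allBits b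
∈-allBits []      = here refl
∈-allBits (c ∷ v) = ∈-map⁺ (λ (c , v) → c Vec.∷ v) (∈-cartesianProduct⁺ (bool c) (∈-allBits v))
  where
  bool : ∀ c → c ∈ false ∷ true ∷ []
  bool false = here refl
  bool true  = there (here refl)

basis-unique : ∀ n b s → Unique (basis n b s)
basis-unique n b s = cartesianProduct⁺ (allFin⁺ n)
  (cartesianProduct⁺ (allFin⁺ n) (cartesianProduct⁺ (allBits-unique b) (allFin⁺ s)))

∈-basis : ∀ {n b s} (e : Basis n b s) → e ∈ basis n b s
∈-basis (i , j , z , w) = ∈-cartesianProduct⁺ (∈-allFin i)
  (∈-cartesianProduct⁺ (∈-allFin j) (∈-cartesianProduct⁺ (∈-allBits z) (∈-allFin w)))

-- Norm preservation and total probability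

module ℂSemiring = CommutativeSemiring ℂ-commutativeSemiring

conj-0 : conj 0ᶜ ≈ᶜ 0ᶜ
conj-0 = pointwiseᶜ {conj 0ᶜ} {0ᶜ} (λ _ → refl) (λ _ → refl)

conj-1 : conj 1ᶜ ≈ᶜ 1ᶜ
conj-1 = pointwiseᶜ {conj 1ᶜ} {1ᶜ} (λ _ → refl) (λ _ → refl)

conj-+ : ∀ z w → conj (z +ᶜ w) ≈ᶜ conj z +ᶜ conj w
conj-+ z w = pointwiseᶜ {conj (z +ᶜ w)} {conj z +ᶜ conj w} (λ _ → refl)
  (λ n → ℚ.neg-distrib-+ (seq (im z) n) (seq (im w) n))

conj-* : ∀ z w → conj (z *ᶜ w) ≈ᶜ conj z *ᶜ conj w
conj-* z w = pointwiseᶜ {conj (z *ᶜ w)} {conj z *ᶜ conj w}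
  (λ n → solve 4 (λ a b c d → a :* c :- b :* d := a :* c :- (:- b) :* (:- d)) refl
    (seq (re z) n) (seq (im z) n) (seq (re w) n) (seq (im w) n))
  (λ n → solve 4 (λ a b c d → :- (a :* d :+ b :* c) := a :* (:- d) :+ (:- b) :* c) refl
    (seq (re z) n) (seq (im z) n) (seq (re w) n) (seq (im w) n))
  where open +-*-Solver

module ℂNorm n b s = ListSum.Norm ℂ-commutativeSemiring conj conj-0 conj-1 conj-+ conj-*
  (_≟ᴮ_ {n} {b} {s}) (basis-unique n b s) ∈-basis

module _ {n b s : ℕ} where
  open ℂNorm n b s
  open ListSum ℂ-commutativeSemiring

  -- Each round is a permutation of the basis followed by a unitary matrix, and both preserve the
  -- norm.
  norm-evolution : ∀ {T} x (ψ : State n b s) (Us : Vec (Unitary n b s) T) →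
    norm (Vec.foldl′ (λ ψ U → apply (matrix U) (query x ψ)) ψ Us) ≈ᶜ norm ψ
  norm-evolution x ψ []       = ℂSemiring.refl {norm ψ}
  norm-evolution x ψ (U ∷ Us) = begin
    norm (Vec.foldl′ (λ ψ U → apply (matrix U) (query x ψ)) ψ (U ∷ Us))
      ≈⟨ norm-evolution x (apply (matrix U) (query x ψ)) Us ⟩
    norm (apply (matrix U) (query x ψ))
      ≈⟨ norm-isometry (matrix U) (query x ψ) (proj₁ (isUnitary U)) ⟩
    norm (query x ψ)
      ≈⟨ Σ-basis-xor x (λ e → conj (ψ e) *ᶜ ψ e) ⟩
    norm ψ ∎
    where open import Relation.Binary.Reasoning.Setoid ℂSemiring.setoid

module _ {n b T : ℕ} (C : Circuit n b T) where
  open Circuit C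

  total-probability : ∀ x → ∑ᴿ (λ e → ∣ finalState x e ∣²) ≈ᴿ 1ᴿ
  total-probability x = ≈ᴿ.trans {∑ᴿ (λ e → ∣ ψ e ∣²)} {re (∑ᶜ λ e → conj (ψ e) *ᶜ ψ e)} {1ᴿ}
    (pointwise {∑ᴿ (λ e → ∣ ψ e ∣²)} {re (∑ᶜ λ e → conj (ψ e) *ᶜ ψ e)} (λ m → real-part m (basis n b workspace)))
    (proj₁ norm≈1)
    where
    open import Relation.Binary.Reasoning.Setoid ℂSemiring.setoid hiding (start)
    open ℂNorm n b workspace
    ψ = finalState x
    norm≈1 : ∑ᶜ (λ e → conj (ψ e) *ᶜ ψ e) ≈ᶜ 1ᶜ
    norm≈1 = begin
      norm ψ                              ≈⟨ norm-evolution x (apply (matrix U₀) (δ start)) Us ⟩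
      norm (apply (matrix U₀) (δ start)) ≈⟨ norm-isometry (matrix U₀) (δ start) (proj₁ (isUnitary U₀)) ⟩
      norm (δ start)                      ≈⟨ norm-indicator start ⟩
      1ᶜ                                  ∎
    -- The real part of `conj z *ᶜ z` is `a * a - (- b) * b`, so the complex norm and the sum of
    -- probabilities agree exactly at each index.
    real-part : ∀ m es → seq (foldr (λ e t → ∣ ψ e ∣² +ᴿ t) 0ᴿ es) m ≡
      seq (re (foldr (λ e t → (conj (ψ e) *ᶜ ψ e) +ᶜ t) 0ᶜ es)) m
    real-part m []       = refl
    real-part m (e ∷ es) = cong₂ ℚ._+_
      (solve 2 (λ a b → a :* a :+ b :* b := a :* a :- (:- b) :* b) refl (seq (re (ψ e)) m) (seq (im (ψ e)) m))
      (real-part m es)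
      where open +-*-Solver

-- Degree of functions of bits

-- The discrete derivative in the first bit, which is the coefficient of that variable in the
-- multilinear polynomial of `f`.
∂ : ∀ {n} → (Bits (suc n) → ℚ) → Bits n → ℚ
∂ f x = f (true ∷ x) ℚ.- f (false ∷ x)

-- The multilinear polynomial of f has degree less than k; k = 0 means f = 0.
Degree< : ∀ n → ℕ → (Bits n → ℚ) → Set
Degree< n       zero    f = ∀ x → f x ≡ 0ℚ
Degree< zero    (suc k) f = ⊤
Degree< (suc n) (suc k) f = Degree< n (suc k) (f ∘ (false ∷_)) × Degree< n k (∂ f)

degree-resp : ∀ n k {f g} → (∀ x → f x ≡ g x) → Degree< n k f → Degree< n k g
degree-resp n       zero    f≡g df = λ x → trans (sym (f≡g x)) (df x)
degree-resp zero    (suc k) f≡g df = tt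
degree-resp (suc n) (suc k) f≡g (d₀ , d₁) =
  degree-resp n (suc k) (λ x → f≡g (false ∷ x)) d₀ ,
  degree-resp n k (λ x → cong₂ ℚ._-_ (f≡g (true ∷ x)) (f≡g (false ∷ x))) d₁

degree-0 : ∀ n k → Degree< n k (λ _ → 0ℚ)
degree-0 n       zero    = λ _ → refl
degree-0 zero    (suc k) = tt
degree-0 (suc n) (suc k) = degree-0 n (suc k) , degree-0 n k

degree-const : ∀ n k c → Degree< n (suc k) (λ _ → c)
degree-const zero    k c = tt
degree-const (suc n) k c = degree-const n k c ,
  degree-resp n k (λ _ → sym (ℚ.+-inverseʳ c)) (degree-0 n k)

degree-suc : ∀ n k {f} → Degree< n k f → Degree< n (suc k) f
degree-suc n       zero    df = degree-resp n 1 (λ x → sym (df x)) (degree-0 n 1)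
degree-suc zero    (suc k) df = tt
degree-suc (suc n) (suc k) (d₀ , d₁) = degree-suc n (suc k) d₀ , degree-suc n k d₁

degree-≤ : ∀ n {k l f} → k ℕ.≤ l → Degree< n k f → Degree< n l f
degree-≤ n k≤l = go (ℕ.≤⇒≤′ k≤l)
  where
  go : ∀ {k l f} → k ℕ.≤′ l → Degree< n k f → Degree< n l f
  go ℕ.≤′-refl        df = df
  go (ℕ.≤′-step k≤′l) df = degree-suc n _ (go k≤′l df)

degree-+ : ∀ n k {f g} → Degree< n k f → Degree< n k g → Degree< n k (λ x → f x ℚ.+ g x)
degree-+ n       zero    df dg = λ x → cong₂ ℚ._+_ (df x) (dg x)
degree-+ zero    (suc k) df dg = tt
degree-+ (suc n) (suc k) {f} {g} (f₀ , f₁) (g₀ , g₁) = degree-+ n (suc k) f₀ g₀ ,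
  degree-resp n k
    (λ x → solve 4 (λ a b c d → (a :- b) :+ (c :- d) := (a :+ c) :- (b :+ d)) refl
      (f (true ∷ x)) (f (false ∷ x)) (g (true ∷ x)) (g (false ∷ x)))
    (degree-+ n k f₁ g₁)
  where open +-*-Solver

degree-neg : ∀ n k {f} → Degree< n k f → Degree< n k (λ x → ℚ.- f x)
degree-neg n       zero    df = λ x → cong (ℚ.-_) (df x)
degree-neg zero    (suc k) df = tt
degree-neg (suc n) (suc k) {f} (d₀ , d₁) = degree-neg n (suc k) d₀ ,
  degree-resp n k
    (λ x → solve 2 (λ a b → :- (a :- b) := (:- a) :- (:- b)) refl (f (true ∷ x)) (f (false ∷ x)))
    (degree-neg n k d₁)
  where open +-*-Solver

-- By the discrete Leibniz rule, the derivative of the product is `∂ f * g₁ + f₀ * ∂ g`, where the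
-- subscript is the value of the first bit and `g₁` is rewritten as `∂ g + g₀`. The second bound has
-- the form `suc l`, that is, degree at most `l`, so that the strict bounds add up without
-- subtraction.
degree-* : ∀ n k l {f g} → Degree< n k f → Degree< n (suc l) g → Degree< n (k ℕ.+ l) (λ x → f x ℚ.* g x)
degree-* n       zero    l {f} {g} df dg = degree-resp n l
  (λ x → sym (trans (cong (ℚ._* g x) (df x)) (ℚ.*-zeroˡ (g x)))) (degree-0 n l)
degree-* zero    (suc k) l df dg = tt
degree-* (suc n) (suc k) l {f} {g} (f₀ , f₁) (g₀ , g₁) = degree-* n (suc k) l f₀ g₀ ,
  degree-resp n (k ℕ.+ l)
    (λ x → solve 4 (λ a b c d → (a :- b) :* ((c :- d) :+ d) :+ b :* (c :- d) := a :* c :- b :* d) refl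
      (f (true ∷ x)) (f (false ∷ x)) (g (true ∷ x)) (g (false ∷ x)))
    (degree-+ n (k ℕ.+ l)
      (degree-* n k l f₁ (degree-+ n (suc l) (degree-suc n l g₁) g₀))
      (f₀*∂g l g₁))
  where
  open +-*-Solver
  -- The recursive call needs a successor as the bound for `∂ g`; at `l = 0` the derivative is zero
  -- and so is the product.
  f₀*∂g : ∀ l → Degree< n l (∂ g) → Degree< n (k ℕ.+ l) (λ x → f (false ∷ x) ℚ.* ∂ g x)
  f₀*∂g zero    ∂g≡0 = degree-resp n (k ℕ.+ 0)
    (λ x → sym (trans (cong (f (false ∷ x) ℚ.*_) (∂g≡0 x)) (ℚ.*-zeroʳ (f (false ∷ x)))))
    (degree-0 n (k ℕ.+ 0))
  f₀*∂g (suc l) d∂g = degree-≤ n (ℕ.≤-reflexive (sym (ℕ.+-suc k l))) (degree-* n (suc k) l f₀ d∂g)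

bit : Bool → ℚ
bit b = if b then 1ℚ else 0ℚ

degree-lookup : ∀ {n} (i : Fin n) → Degree< n 2 (λ x → bit (lookup x i))
degree-lookup {suc n} zero    = degree-0 n 2 , degree-const n 0 1ℚ
degree-lookup {suc n} (suc i) = degree-lookup i ,
  degree-resp n 1 (λ x → sym (ℚ.+-inverseʳ (bit (lookup x i)))) (degree-0 n 1)

-- Selection by a bit is the polynomial `(f - g) * xᵢ + g`, whose only new factor is one variable.
degree-if : ∀ {n} k {f g} (i : Fin n) → Degree< n k f → Degree< n k g →
  Degree< n (suc k) (λ x → if lookup x i then f x else g x)
degree-if {n} k {f} {g} i df dg = degree-resp n (suc k) eq
  (degree-+ n (suc k)
    (degree-≤ n (ℕ.≤-reflexive (ℕ.+-comm k 1))
      (degree-* n k 1 (degree-+ n k df (degree-neg n k dg)) (degree-lookup i)))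
    (degree-suc n k dg))
  where
  open +-*-Solver
  eq : ∀ x → (f x ℚ.- g x) ℚ.* bit (lookup x i) ℚ.+ g x ≡ (if lookup x i then f x else g x)
  eq x with lookup x i
  ... | true  = solve 2 (λ a b → (a :- b) :* con 1ℚ :+ b := a) refl (f x) (g x)
  ... | false = solve 2 (λ a b → (a :- b) :* con 0ℚ :+ b := b) refl (f x) (g x)

-- The parity character, -1 to the number of `false` bits. Counting `false` rather than `true` makes
-- the sum over the first bit produce `∂` with the right sign.
sign : ∀ {n} → Bits n → ℚ
sign []          = 1ℚ
sign (true ∷ x)  = sign x
sign (false ∷ x) = ℚ.- sign x

-- Summing out one bit at a time replaces f by ∂ f, so Σₓ sign x * f x is the
-- full mixed difference of f, which vanishes in degree less than n.
sign-correlation : ∀ n {f} → Degree< n n f → (∀ x → 0ℚ ℚ.< sign x ℚ.* f x) → 0ℚ ℚ.< 0ℚ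
sign-correlation zero    {f} df pos = subst (0ℚ ℚ.<_) (cong (1ℚ ℚ.*_) (df [])) (pos [])
sign-correlation (suc n) {f} (_ , d∂f) pos = sign-correlation n d∂f λ x →
  subst (0ℚ ℚ.<_)
    (solve 3 (λ s a b → s :* a :+ (:- s) :* b := s :* (a :- b)) refl (sign x) (f (true ∷ x)) (f (false ∷ x)))
    (ℚ.+-mono-< (pos (true ∷ x)) (pos (false ∷ x)))
  where open +-*-Solver

-- The order on the reals and approximate comparison

≤ᴿ-isPartialOrder : IsPartialOrder _≈ᴿ_ _≤ᴿ_
≤ᴿ-isPartialOrder = record
  { isPreorder = record
    { isEquivalence = ≈ᴿ-isEquivalence
    ; reflexive     = λ {x} {y} x≈y ε 0<ε → eventually-map
        (λ n lt → ≤-shift (ℚ.≤-trans (p≤∣p∣ (seq x n ℚ.- seq y n)) (ℚ.<⇒≤ lt))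
          (solve 3 (λ a b e → (b :+ e) :- a := e :- (a :- b)) refl (seq x n) (seq y n) ε))
        (x≈y ε 0<ε)
    ; trans         = λ {x} {y} {z} x≤y y≤z ε 0<ε → eventually-zip
        (λ n p q → ≤-shift (ℚ.+-mono-≤ p q)
          (trans (cong (λ e → (seq z n ℚ.+ e) ℚ.- seq x n) (sym (half+half ε)))
            (solve 4 (λ a b c e → (c :+ (e :+ e)) :- a := ((b :+ e) :+ (c :+ e)) :- (a :+ b)) refl
              (seq x n) (seq y n) (seq z n) (half ε))))
        (x≤y (half ε) (half-pos 0<ε)) (y≤z (half ε) (half-pos 0<ε))
    }
  ; antisym = λ {x} {y} x≤y y≤x ε 0<ε → eventually-zip
      (λ n p q → ℚ.≤-<-trans
        (∣-∣-least
          (≤-shift p (solve 3 (λ a b e → e :- (a :- b) := (b :+ e) :- a) refl (seq x n) (seq y n) (half ε)))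
          (≤-shift q (solve 3 (λ a b e → e :- (:- (a :- b)) := (a :+ e) :- b) refl (seq x n) (seq y n) (half ε))))
        (half-< 0<ε))
      (x≤y (half ε) (half-pos 0<ε)) (y≤x (half ε) (half-pos 0<ε))
  }
  where open +-*-Solver

fromℚ-mono : ∀ {p q} → p ℚ.≤ q → fromℚ p ≤ᴿ fromℚ q
fromℚ-mono {p} {q} p≤q ε 0<ε = always λ _ →
  ℚ.≤-trans p≤q (subst (ℚ._≤ q ℚ.+ ε) (ℚ.+-identityʳ q) (ℚ.+-monoʳ-≤ q (ℚ.<⇒≤ 0<ε)))

fromℚ-injective : ∀ p q → fromℚ p ≈ᴿ fromℚ q → p ≡ q
fromℚ-injective p q p≈q with ℚ.∣ p ℚ.- q ∣ ℚ.≤? 0ℚ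
... | yes ∣p-q∣≤0 = begin
    p                  ≡⟨ solve 2 (λ a b → a := (a :- b) :+ b) refl p q ⟩
    (p ℚ.- q) ℚ.+ q    ≡⟨ cong (ℚ._+ q) (ℚ.∣p∣≡0⇒p≡0 _ (ℚ.≤-antisym ∣p-q∣≤0 (ℚ.0≤∣p∣ _))) ⟩
    0ℚ ℚ.+ q           ≡⟨ ℚ.+-identityˡ q ⟩
    q                  ∎
  where open ≡.≡-Reasoning
        open +-*-Solver
-- A positive distance can serve as its own tolerance, which makes it smaller than itself.
... | no  ∣p-q∣≰0 = contradiction (proj₂ (eventually-at (p≈q _ (ℚ.≰⇒> ∣p-q∣≰0)))) (ℚ.<-irrefl refl)

-- Error budget with `η = ε / 4`. If the real is at least `q`, its term `a` is at least `q - η` and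
-- the sampled term `c` exceeds `q - 2η`. In `threshold-below`, `b ≤ q - 4η` gives `a ≤ q - 3η` and
-- then `c < q - 2η`.
threshold-above : ∀ q η a c → q ℚ.≤ a ℚ.+ η → ∣ a ℚ.- c ∣ ℚ.< η → q ℚ.- (η ℚ.+ η) ℚ.< c
threshold-above q η a c q≤ near =
  <-shift (ℚ.+-mono-≤-< q≤ (ℚ.≤-<-trans (p≤∣p∣ (a ℚ.- c)) near))
    (solve 4 (λ q e a c → c :- (q :- (e :+ e)) := ((a :+ e) :+ e) :- (q :+ (a :- c))) refl q η a c)
  where open +-*-Solver

threshold-below : ∀ q η a b c → b ℚ.+ ((η ℚ.+ η) ℚ.+ (η ℚ.+ η)) ℚ.≤ q → a ℚ.≤ b ℚ.+ η →
  ∣ a ℚ.- c ∣ ℚ.< η → c ℚ.< q ℚ.- (η ℚ.+ η)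
threshold-below q η a b c b≤ a≤ near =
  <-shift (ℚ.+-mono-≤-< (ℚ.+-mono-≤ b≤ a≤) (ℚ.≤-<-trans (p≤∣p∣ (c ℚ.- a)) (subst (ℚ._< η) (∣-∣-swap a c) near)))
    (solve 5 (λ q e a b c → (q :- (e :+ e)) :- c :=
        ((q :+ (b :+ e)) :+ e) :- (((b :+ ((e :+ e) :+ (e :+ e))) :+ a) :+ (c :- a))) refl q η a b c)
  where open +-*-Solver

-- Since seq a (cutoff a) is within ε/4 of a, comparing it with q - ε/2
-- separates a ≥ q from a ≤ q - ε.
module Threshold (q ε : ℚ) (0<ε : 0ℚ ℚ.< ε) where

  private
    η = half (half ε)
    0<η : 0ℚ ℚ.< η
    0<η = half-pos (half-pos 0<ε)
    ε≡4η : ε ≡ (η ℚ.+ η) ℚ.+ (η ℚ.+ η)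
    ε≡4η = trans (sym (half+half ε)) (sym (cong₂ ℚ._+_ (half+half (half ε)) (half+half (half ε))))

  cutoff : ℝ → ℕ
  cutoff a = proj₁ (cauchy a η 0<η)

  private
    level : ℚ
    level = q ℚ.- (η ℚ.+ η)

  above : ℝ → Bool
  above a = does (level ℚ.<? seq a (cutoff a))

  private
    close : ∀ a → Eventually λ n → ∣ seq a n ℚ.- seq a (cutoff a) ∣ ℚ.< η
    close a = cutoff a , λ n ≤n → proj₂ (cauchy a η 0<η) n (cutoff a) ≤n ℕ.≤-refl

  above-true : ∀ a → fromℚ q ≤ᴿ a → above a ≡ true
  above-true a q≤a = dec-true (level ℚ.<? seq a (cutoff a))
    (let n , q≤ , near = eventually-at (eventually-zip (λ _ → _,_) (q≤a η 0<η) (close a))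
     in threshold-above q η (seq a n) (seq a (cutoff a)) q≤ near)

  above-false : ∀ a b → a ≤ᴿ b → Eventually (λ n → seq b n ℚ.+ ε ℚ.≤ q) → above a ≡ false
  above-false a b a≤b b+ε≤q = dec-false (level ℚ.<? seq a (cutoff a)) (ℚ.<-asym
    (let n , b≤ , a≤ , near = eventually-at
           (eventually-zip (λ _ → _,_) b+ε≤q (eventually-zip (λ _ → _,_) (a≤b η 0<η) (close a)))
     in threshold-below q η (seq a n) (seq b n) (seq a (cutoff a))
          (subst (λ e → seq b n ℚ.+ e ℚ.≤ q) ε≡4η b≤) a≤ near))

-- There are finitely many strings, so one index works for all of them. This lets the degree
-- argument run over the rationals at a single index.
eventually-all : ∀ n {P : Bits n → ℕ → Set} → (∀ x → Eventually (P x)) → Eventually (λ m → ∀ x → P x m)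
eventually-all zero    p = eventually-map (λ { m q [] → q }) (p [])
eventually-all (suc n) p = eventually-zip
  (λ { m q r (false ∷ x) → q x ; m q r (true ∷ x) → r x })
  (eventually-all n (λ x → p (false ∷ x))) (eventually-all n (λ x → p (true ∷ x)))

-- The polynomial method for circuits

module _ {N n b : ℕ} (entry : Fin n → Fin n → Bits b ⊎ Fin N) (c₀ c₁ : Bits b) where

  -- A table entry is either a known constant or a choice governed by one hidden bit. On each basis
  -- state a query therefore depends on at most one hidden bit.
  resolve : Bits N → Bits b ⊎ Fin N → Bits b
  resolve x (inj₁ c) = c
  resolve x (inj₂ k) = if lookup x k then c₁ else c₀

  table : Bits N → Fin n → Fin n → Bits b
  table x i j = resolve x (entry i j)

  -- Degree is imposed at each index of the Cauchy sequences. Circuit steps act termwise, so this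
  -- property propagates exactly, with no passage to the limit.
  Degreeᴿ< : ℕ → (Bits N → ℝ) → Set
  Degreeᴿ< k f = ∀ m → Degree< N k (λ x → seq (f x) m)

  Degreeᶜ< : ℕ → (Bits N → ℂ) → Set
  Degreeᶜ< k f = Degreeᴿ< k (λ x → re (f x)) × Degreeᴿ< k (λ x → im (f x))

  degreeᶜ-if : ∀ k {f g} (i : Fin N) → Degreeᶜ< k f → Degreeᶜ< k g →
    Degreeᶜ< (suc k) (λ x → if lookup x i then f x else g x)
  degreeᶜ-if k {f} {g} i (fr , fi) (gr , gi) =
    (λ m → degree-resp N (suc k) (λ x → push (lookup x i) (λ z → seq (re z) m)) (degree-if k i (fr m) (gr m))) ,
    (λ m → degree-resp N (suc k) (λ x → push (lookup x i) (λ z → seq (im z) m)) (degree-if k i (fi m) (gi m)))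
    where
    push : ∀ c (h : ℂ → ℚ) {z w} → (if c then h z else h w) ≡ h (if c then z else w)
    push true  h = refl
    push false h = refl

  module _ {s : ℕ} where

    -- At a fixed basis state the new amplitude is one old amplitude, or a selection by one hidden
    -- bit between two of them, which costs one degree.
    degree-query : ∀ k (Ψ : Bits N → State n b s) → (∀ e → Degreeᶜ< k (λ x → Ψ x e)) →
      ∀ e → Degreeᶜ< (suc k) (λ x → query (table x) (Ψ x) e)
    degree-query k Ψ d (i , j , z , w) with entry i j
    ... | inj₁ c = (λ m → degree-suc N k (proj₁ (d _) m)) , (λ m → degree-suc N k (proj₂ (d _) m))
    ... | inj₂ l =
      (λ m → degree-resp N (suc k) (λ x → push (lookup x l) x (λ z → seq (re z) m)) (proj₁ selected m)) ,
      (λ m → degree-resp N (suc k) (λ x → push (lookup x l) x (λ z → seq (im z) m)) (proj₂ selected m))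
      where
      answer : Bits b → Basis n b s
      answer c = i , j , Vec.zipWith _xor_ z c , w
      selected : Degreeᶜ< (suc k) (λ x → if lookup x l then Ψ x (answer c₁) else Ψ x (answer c₀))
      selected = degreeᶜ-if k l (d (answer c₁)) (d (answer c₀))
      push : ∀ c x (h : ℂ → ℚ) → h (if c then Ψ x (answer c₁) else Ψ x (answer c₀)) ≡
                                  h (Ψ x (answer (if c then c₁ else c₀)))
      push true  x h = refl
      push false x h = refl

    -- The entries of `U` do not depend on the hidden string, so the new amplitudes are constant
    -- linear combinations of the old ones.
    degree-apply : ∀ k U (Ψ : Bits N → State n b s) → (∀ e → Degreeᶜ< (suc k) (λ x → Ψ x e)) →
      ∀ e → Degreeᶜ< (suc k) (λ x → apply U (Ψ x) e)
    degree-apply k U Ψ d e =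
      (λ m → real m (basis n b s)) , (λ m → imaginary m (basis n b s))
      where
      scaled : ∀ c {f} → Degree< N (suc k) f → Degree< N (suc k) (λ x → c ℚ.* f x)
      scaled c df = degree-* N 1 k (degree-const N 0 c) df
      real : ∀ m es → Degree< N (suc k)
        (λ x → seq (re (foldr (λ f t → (U e f *ᶜ Ψ x f) +ᶜ t) 0ᶜ es)) m)
      real m []       = degree-0 N (suc k)
      real m (f ∷ es) = degree-+ N (suc k)
        (degree-+ N (suc k) (scaled (seq (re (U e f)) m) (proj₁ (d f) m))
          (degree-neg N (suc k) (scaled (seq (im (U e f)) m) (proj₂ (d f) m))))
        (real m es)
      imaginary : ∀ m es → Degree< N (suc k)
        (λ x → seq (im (foldr (λ f t → (U e f *ᶜ Ψ x f) +ᶜ t) 0ᶜ es)) m)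
      imaginary m []       = degree-0 N (suc k)
      imaginary m (f ∷ es) = degree-+ N (suc k)
        (degree-+ N (suc k) (scaled (seq (re (U e f)) m) (proj₂ (d f) m))
          (scaled (seq (im (U e f)) m) (proj₁ (d f) m)))
        (imaginary m es)

    -- The left fold updates the state before recursing, so the statement is generalized over the
    -- current state and its degree `k`.
    degree-evolution : ∀ {T} k (Us : Vec (Unitary n b s) T) (Ψ : Bits N → State n b s) →
      (∀ e → Degreeᶜ< (suc k) (λ x → Ψ x e)) → ∀ e → Degreeᶜ< (suc (k ℕ.+ T))
        (λ x → Vec.foldl′ (λ ψ U → apply (matrix U) (query (table x) ψ)) (Ψ x) Us e)
    degree-evolution k []       Ψ d e =
      (λ m → degree-≤ N k+1≤ (proj₁ (d e) m)) , (λ m → degree-≤ N k+1≤ (proj₂ (d e) m))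
      where k+1≤ = s≤s (ℕ.m≤m+n k 0)
    degree-evolution {suc T} k (U ∷ Us) Ψ d e =
      (λ m → degree-≤ N ≤T (proj₁ rec m)) , (λ m → degree-≤ N ≤T (proj₂ rec m))
      where
      ≤T = ℕ.≤-reflexive (cong suc (sym (ℕ.+-suc k T)))
      rec = degree-evolution (suc k) Us (λ x → apply (matrix U) (query (table x) (Ψ x)))
        (degree-apply (suc k) (matrix U) _ (degree-query (suc k) Ψ d)) e

  module _ {T : ℕ} (C : Circuit n b T) where
    open Circuit C

    degree-finalState : ∀ e → Degreeᶜ< (suc T) (λ x → finalState (table x) e)
    degree-finalState = degree-evolution 0 Us _ (λ e →
      (λ m → degree-const N 0 _) , (λ m → degree-const N 0 _))

    signExpectation : (Basis n b workspace → Bits N) → Bits N → ℝ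
    signExpectation y x = ∑ᴿ (λ e → fromℚ (sign (y e)) *ᴿ ∣ finalState (table x) e ∣²)

    -- A probability is a sum of two squares of polynomials of degree at most `T`, and the weights
    -- `sign (y e)` are constants.
    degree-signExpectation : ∀ y → Degreeᴿ< (suc (T ℕ.+ T)) (signExpectation y)
    degree-signExpectation y m = go (basis n b workspace)
      where
      go : ∀ es → Degree< N (suc (T ℕ.+ T))
        (λ x → seq (foldr (λ e t → fromℚ (sign (y e)) *ᴿ ∣ finalState (table x) e ∣² +ᴿ t) 0ᴿ es) m)
      go []       = degree-0 N (suc (T ℕ.+ T))
      go (e ∷ es) = degree-+ N (suc (T ℕ.+ T))
        (degree-* N 1 (T ℕ.+ T) (degree-const N 0 (sign (y e)))
          (degree-+ N (suc (T ℕ.+ T)) (square (proj₁ (degree-finalState e) m)) (square (proj₂ (degree-finalState e) m))))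
        (go es)
        where
        square : ∀ {f} → Degree< N (suc T) f → Degree< N (suc (T ℕ.+ T)) (λ x → f x ℚ.* f x)
        square df = degree-* N (suc T) T df df

-- Correlation of the output with parity

sign-±1 : ∀ {n} (x : Bits n) → sign x ≡ 1ℚ ⊎ sign x ≡ ℚ.- 1ℚ
sign-±1 []          = inj₁ refl
sign-±1 (true ∷ x)  = sign-±1 x
sign-±1 (false ∷ x) with sign-±1 x
... | inj₁ eq = inj₂ (cong ℚ.-_ eq)
... | inj₂ eq = inj₁ (cong ℚ.-_ eq)

-- The product of the two signs is 1 or -1, so the right side is `2p` or 0. A correct guess forces
-- `2p`, and any other guess still contributes nothing negative.
sign-guess : ∀ {n} (x y : Bits n) p c → 0ℚ ℚ.≤ p → (c ≡ true → y ≡ x) →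
  (if c then p ℚ.+ p else 0ℚ) ℚ.≤ sign x ℚ.* (sign y ℚ.* p) ℚ.+ p
sign-guess x y p true 0≤p y≡x rewrite y≡x refl with sign x | sign-±1 x
... | _ | inj₁ refl = ℚ.≤-reflexive (solve 1 (λ p → p :+ p := con 1ℚ :* (con 1ℚ :* p) :+ p) refl p)
  where open +-*-Solver
... | _ | inj₂ refl = ℚ.≤-reflexive (solve 1 (λ p → p :+ p := con (ℚ.- 1ℚ) :* (con (ℚ.- 1ℚ) :* p) :+ p) refl p)
  where open +-*-Solver
sign-guess x y p false 0≤p _ with sign x | sign-±1 x | sign y | sign-±1 y
... | _ | inj₁ refl | _ | inj₁ refl = ≤-shift (ℚ.+-mono-≤ 0≤p 0≤p)
  (solve 1 (λ p → (con 1ℚ :* (con 1ℚ :* p) :+ p) :- con 0ℚ := (p :+ p) :- con 0ℚ) refl p)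
  where open +-*-Solver
... | _ | inj₂ refl | _ | inj₂ refl = ≤-shift (ℚ.+-mono-≤ 0≤p 0≤p)
  (solve 1 (λ p → (con (ℚ.- 1ℚ) :* (con (ℚ.- 1ℚ) :* p) :+ p) :- con 0ℚ := (p :+ p) :- con 0ℚ) refl p)
  where open +-*-Solver
... | _ | inj₁ refl | _ | inj₂ refl = ℚ.≤-reflexive
  (solve 1 (λ p → con 0ℚ := con 1ℚ :* (con (ℚ.- 1ℚ) :* p) :+ p) refl p)
  where open +-*-Solver
... | _ | inj₂ refl | _ | inj₁ refl = ℚ.≤-reflexive
  (solve 1 (λ p → con 0ℚ := con (ℚ.- 1ℚ) :* (con 1ℚ :* p) :+ p) refl p)
  where open +-*-Solver

square-nonneg : ∀ p → 0ℚ ℚ.≤ p ℚ.* p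
square-nonneg p = subst (0ℚ ℚ.≤_) (absorb (ℚ.∣p∣≡p∨∣p∣≡-p p))
  (ℚ.nonNegative⁻¹ (∣ p ∣ ℚ.* ∣ p ∣) {{ℚ.nonNeg*nonNeg⇒nonNeg (∣ p ∣) {{ℚ.∣-∣-nonNeg p}} (∣ p ∣) {{ℚ.∣-∣-nonNeg p}}}})
  where
  open +-*-Solver
  absorb : ∣ p ∣ ≡ p ⊎ ∣ p ∣ ≡ ℚ.- p → ∣ p ∣ ℚ.* ∣ p ∣ ≡ p ℚ.* p
  absorb (inj₁ eq) = cong₂ ℚ._*_ eq eq
  absorb (inj₂ eq) = trans (cong₂ ℚ._*_ eq eq) (solve 1 (λ p → (:- p) :* (:- p) := p :* p) refl p)

∣∣²-nonneg : ∀ z m → 0ℚ ℚ.≤ seq ∣ z ∣² m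
∣∣²-nonneg z m = ℚ.+-mono-≤ (square-nonneg (seq (re z) m)) (square-nonneg (seq (im z) m))

module _ {N n b T : ℕ} (entry : Fin n → Fin n → Bits b ⊎ Fin N) (c₀ c₁ : Bits b) (C : Circuit n b T) where
  open Circuit C

  private
    -- The guessing game behind the bound: the outcomes in `S` identify the hidden string and carry
    -- probability at least 2/3. Metrics no longer appear.
    Learns : (Basis n b workspace → Bits N) → Bits N → (Basis n b workspace → Bool) → Set
    Learns y x S = (∀ e → S e ≡ true → y e ≡ x) ×
      fromℚ (+ 2 / 3) ≤ᴿ ∑ᴿ (λ e → if S e then ∣ finalState (table entry c₀ c₁ x) e ∣² else 0ᴿ)

  sign-positive : ∀ y x S → Learns y x S →
    Eventually (λ m → 0ℚ ℚ.< sign x ℚ.* seq (signExpectation entry c₀ c₁ C y x) m)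
  sign-positive y x S (y≡x , likely) = eventually-zip positive
    (likely ε 0<ε) (total-probability C X ε 0<ε)
    where
    open +-*-Solver
    X = table entry c₀ c₁ x
    -- The correlation exceeds `2 (2/3 - ε) - (1 + ε) = 1/3 - 3ε`, and this choice makes the
    -- remainder equal to `ε`.
    ε = + 1 / 12
    0<ε : 0ℚ ℚ.< ε
    0<ε = ℚ.positive⁻¹ ε
    p : Basis n b workspace → ℝ
    p e = ∣ finalState X e ∣²
    -- `sign-guess` summed over the outcomes: twice the success probability is at most the
    -- correlation plus the total probability, exactly at each index.
    twice : ∀ m es →
      seq (foldr (λ e t → (if S e then p e else 0ᴿ) +ᴿ t) 0ᴿ es) m ℚ.+
      seq (foldr (λ e t → (if S e then p e else 0ᴿ) +ᴿ t) 0ᴿ es) m ℚ.≤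
      sign x ℚ.* seq (foldr (λ e t → fromℚ (sign (y e)) *ᴿ p e +ᴿ t) 0ᴿ es) m ℚ.+
      seq (foldr (λ e t → p e +ᴿ t) 0ᴿ es) m
    twice m []       = ℚ.≤-reflexive (solve 1 (λ s → con 0ℚ :+ con 0ℚ := s :* con 0ℚ :+ con 0ℚ) refl (sign x))
    twice m (e ∷ es) = ≤-shift
      (ℚ.+-mono-≤ (sign-guess x (y e) (seq (p e) m) (S e) (∣∣²-nonneg (finalState X e) m) (y≡x e)) (twice m es))
      (trans
        (solve 6 (λ s q p a b′ t → (s :* (q :+ b′) :+ (p :+ t)) :- (a :+ a) :=
          ((s :* q :+ p) :+ (s :* b′ :+ t)) :- (a :+ a)) refl
          (sign x) (sign (y e) ℚ.* seq (p e) m) (seq (p e) m)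
          (seq (if S e then p e else 0ᴿ) m ℚ.+ A) B D)
        (cong (λ r → ((sign x ℚ.* (sign (y e) ℚ.* seq (p e) m) ℚ.+ seq (p e) m) ℚ.+ (sign x ℚ.* B ℚ.+ D)) ℚ.- r)
          (double (S e))))
      where
      A = seq (foldr (λ e t → (if S e then p e else 0ᴿ) +ᴿ t) 0ᴿ es) m
      B = seq (foldr (λ e t → fromℚ (sign (y e)) *ᴿ p e +ᴿ t) 0ᴿ es) m
      D = seq (foldr (λ e t → p e +ᴿ t) 0ᴿ es) m
      double : ∀ c → (seq (if c then p e else 0ᴿ) m ℚ.+ A) ℚ.+ (seq (if c then p e else 0ᴿ) m ℚ.+ A) ≡
        (if c then seq (p e) m ℚ.+ seq (p e) m else 0ℚ) ℚ.+ (A ℚ.+ A)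
      double true  = solve 2 (λ p a → (p :+ a) :+ (p :+ a) := (p :+ p) :+ (a :+ a)) refl (seq (p e) m) A
      double false = solve 1 (λ a → (con 0ℚ :+ a) :+ (con 0ℚ :+ a) := con 0ℚ :+ (a :+ a)) refl A
    positive : ∀ m →
      + 2 / 3 ℚ.≤ seq (∑ᴿ (λ e → if S e then p e else 0ᴿ)) m ℚ.+ ε →
      ∣ seq (∑ᴿ p) m ℚ.- 1ℚ ∣ ℚ.< ε →
      0ℚ ℚ.< sign x ℚ.* seq (signExpectation entry c₀ c₁ C y x) m
    positive m 2/3≤ total = ℚ.<-trans 0<ε
      (<-shift
        (ℚ.+-mono-≤-< (ℚ.+-mono-≤ (twice m (basis n b workspace)) (ℚ.+-mono-≤ 2/3≤ 2/3≤))
          (ℚ.≤-<-trans (p≤∣p∣ (seq (∑ᴿ p) m ℚ.- 1ℚ)) total))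
        (solve 3 (λ a q t → q :- con ε :=
            (((q :+ t) :+ ((a :+ con ε) :+ (a :+ con ε))) :+ con ε) :-
            (((a :+ a) :+ (con (+ 2 / 3) :+ con (+ 2 / 3))) :+ (t :- con 1ℚ))) refl
          (seq (∑ᴿ (λ e → if S e then p e else 0ᴿ)) m)
          (sign x ℚ.* seq (signExpectation entry c₀ c₁ C y x) m) (seq (∑ᴿ p) m)))

  -- If `T + T < N`, then `signExpectation` has degree below `N`, yet at one common index its
  -- product with `sign` is positive on every string. `sign-correlation` excludes this.
  learning-lower-bound : ∀ y → (∀ x → ∃[ S ] Learns y x S) → N ℕ.≤ T ℕ.+ T
  learning-lower-bound y learns = ℕ.≮⇒≥ λ 2T<N →
    uncorrelated 2T<N (eventually-at (eventually-all N λ x → sign-positive y x (proj₁ (learns x)) (proj₂ (learns x))))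
    where
    uncorrelated : T ℕ.+ T ℕ.< N →
      ¬ (∃[ m ] ∀ x → 0ℚ ℚ.< sign x ℚ.* seq (signExpectation entry c₀ c₁ C y x) m)
    uncorrelated 2T<N (m , positive) = ℚ.<-irrefl refl
      (sign-correlation N (degree-≤ N 2T<N (degree-signExpectation entry c₀ c₁ C y m)) positive)

-- The hard instances

open import Data.Nat using (_*_; _≤_)

zero′ one two three : Bits 2
zero′ = false ∷ false ∷ []
one   = false ∷ true  ∷ []
two   = true  ∷ false ∷ []
three = true  ∷ true  ∷ []

number : Bits 2 → ℚ
number (false ∷ false ∷ []) = 0ℚ
number (false ∷ true  ∷ []) = 1ℚ
number (true  ∷ false ∷ []) = + 2 / 1
number (true  ∷ true  ∷ []) = + 3 / 1

number⁻¹ : ℚ → Bits 2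
number⁻¹ p = if does (p ℚ.≟ 0ℚ) then zero′ else
  -- The final `three` is also the default for rationals outside the range of `number`; only the
  -- left inverse property matters, as it turns injectivity into a congruence.
  if does (p ℚ.≟ 1ℚ) then one else if does (p ℚ.≟ + 2 / 1) then two else three

number⁻¹-number : ∀ u → number⁻¹ (number u) ≡ u
number⁻¹-number (false ∷ false ∷ []) = refl
number⁻¹-number (false ∷ true  ∷ []) = refl
number⁻¹-number (true  ∷ false ∷ []) = refl
number⁻¹-number (true  ∷ true  ∷ []) = refl

binary : Format 2
binary = record
  { value     = λ u → fromℚ (number u)
  ; injective = λ u v eq → trans (sym (number⁻¹-number u))
      (trans (cong number⁻¹ (fromℚ-injective (number u) (number v) eq)) (number⁻¹-number v))
  }

module Instance (h m : ℕ) where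

  Point : Set
  Point = Fin h ⊎ Fin m

  point : Fin (h ℕ.+ m) → Point
  point = splitAt h

  entry : Point → Point → Bits 2 ⊎ Fin (h * m)
  entry (inj₁ a) (inj₁ b) = inj₁ (if does (a Fin.≟ b) then zero′ else two)
  entry (inj₂ a) (inj₂ b) = inj₁ (if does (a Fin.≟ b) then zero′ else two)
  entry (inj₁ a) (inj₂ b) = inj₂ (combine a b)
  -- The same bit as for the exchanged pair, so cross distances are symmetric by `refl`.
  entry (inj₂ b) (inj₁ a) = inj₂ (combine a b)

  X : Bits (h * m) → Fin (h ℕ.+ m) → Fin (h ℕ.+ m) → Bits 2
  X = table (λ i j → entry (point i) (point j)) one three

  row col : Fin (h * m) → Fin (h ℕ.+ m)
  row k = proj₁ (remQuot m k) ↑ˡ m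
  col k = h ↑ʳ proj₂ (remQuot {h} m k)

  X-row-col : ∀ x k → X x (row k) (col k) ≡ (if lookup x k then three else one)
  X-row-col x k
    rewrite Fin.splitAt-↑ˡ h (proj₁ (remQuot m k)) m
          | Fin.splitAt-↑ʳ h m (proj₂ (remQuot {h} m k))
          | Fin.combine-remQuot {h} m k = refl

  module _ (x : Bits (h * m)) where

    -- Rational distances on split points: the metric axioms become case distinctions on the halves,
    -- and `d i j` is definitionally `fromℚ` of `w (point i) (point j)`.
    w : Point → Point → ℚ
    w p q = number (resolve (λ i j → entry (point i) (point j)) one three x (entry p q))

    private
      same : ∀ {k} → Fin k → Fin k → ℚ
      same a b = number (if does (a Fin.≟ b) then zero′ else two)

      cross : Fin (h * m) → ℚ
      cross k = number (if lookup x k then three else one)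

      same-≥0 : ∀ {k} (a b : Fin k) → 0ℚ ℚ.≤ same a b
      same-≥0 a b with does (a Fin.≟ b)
      ... | true  = ℚ.≤ᵇ⇒≤ tt
      ... | false = ℚ.≤ᵇ⇒≤ tt

      same-≤2 : ∀ {k} (a b : Fin k) → same a b ℚ.≤ + 2 / 1
      same-≤2 a b with does (a Fin.≟ b)
      ... | true  = ℚ.≤ᵇ⇒≤ tt
      ... | false = ℚ.≤ᵇ⇒≤ tt

      same-refl : ∀ {k} (a : Fin k) → same a a ≡ 0ℚ
      same-refl a = cong (λ c → number (if c then zero′ else two)) (dec-true (a Fin.≟ a) refl)

      same-sym : ∀ {k} (a b : Fin k) → same a b ≡ same b a
      same-sym a b with a Fin.≟ b
      ... | yes refl = sym (same-refl a)
      ... | no  a≢b  = cong (λ c → number (if c then zero′ else two)) (sym (dec-false (b Fin.≟ a) λ b≡a → a≢b (sym b≡a)))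

      cross-≥1 : ∀ k → 1ℚ ℚ.≤ cross k
      cross-≥1 k with lookup x k
      ... | true  = ℚ.≤ᵇ⇒≤ tt
      ... | false = ℚ.≤ᵇ⇒≤ tt

      cross-≤3 : ∀ k → cross k ℚ.≤ + 3 / 1
      cross-≤3 k with lookup x k
      ... | true  = ℚ.≤ᵇ⇒≤ tt
      ... | false = ℚ.≤ᵇ⇒≤ tt

      same-same : ∀ {k} (a b c : Fin k) → same a c ℚ.≤ same a b ℚ.+ same b c
      same-same a b c with a Fin.≟ b
      ... | yes refl = ℚ.≤-reflexive (sym (ℚ.+-identityˡ (same a c)))
      ... | no  _    = ℚ.≤-trans (same-≤2 a c) (ℚ.+-monoʳ-≤ (+ 2 / 1) (same-≥0 b c))

      -- The detour through the other half costs at least `1 + 1`, which is the largest distance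
      -- within a half.
      cross-cross : ∀ {k} (a b : Fin k) l l′ → same a b ℚ.≤ cross l ℚ.+ cross l′
      cross-cross a b l l′ = ℚ.≤-trans (same-≤2 a b) (ℚ.+-mono-≤ (cross-≥1 l) (cross-≥1 l′))

      -- For distinct points this is `3 ≤ 2 + 1`, the tight case that fixes the distance 2 within a
      -- half. The map `f` holds the third point fixed in either argument of `combine`, so one lemma
      -- covers both halves.
      same-cross : ∀ {k} (f : Fin k → Fin (h * m)) (a b : Fin k) → cross (f a) ℚ.≤ same a b ℚ.+ cross (f b)
      same-cross f a b with a Fin.≟ b
      ... | yes refl = ℚ.≤-reflexive (sym (ℚ.+-identityˡ (cross (f a))))
      ... | no  _    = ℚ.≤-trans (cross-≤3 (f a)) (ℚ.+-monoʳ-≤ (+ 2 / 1) (cross-≥1 (f b)))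

      cross-same : ∀ {k} (f : Fin k → Fin (h * m)) (a b : Fin k) → cross (f b) ℚ.≤ cross (f a) ℚ.+ same a b
      cross-same f a b = subst (cross (f b) ℚ.≤_)
        (trans (ℚ.+-comm (same b a) (cross (f a))) (cong (cross (f a) ℚ.+_) (same-sym b a)))
        (same-cross f b a)

      cross≢0 : ∀ k → ¬ cross k ≡ 0ℚ
      cross≢0 k eq = contradiction (subst (1ℚ ℚ.≤_) eq (cross-≥1 k)) λ { (ℚ.*≤* (+≤+ ())) }

      same≡0 : ∀ {k} (a b : Fin k) → same a b ≡ 0ℚ → a ≡ b
      same≡0 a b eq with a Fin.≟ b
      ... | yes a≡b = a≡b
      ... | no  _   = contradiction eq λ ()

    w-nonneg : ∀ p q → 0ℚ ℚ.≤ w p q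
    w-nonneg (inj₁ a) (inj₁ b) = same-≥0 a b
    w-nonneg (inj₂ a) (inj₂ b) = same-≥0 a b
    w-nonneg (inj₁ a) (inj₂ b) = ℚ.≤-trans (ℚ.≤ᵇ⇒≤ tt) (cross-≥1 (combine a b))
    w-nonneg (inj₂ b) (inj₁ a) = ℚ.≤-trans (ℚ.≤ᵇ⇒≤ tt) (cross-≥1 (combine a b))

    w-refl : ∀ p → w p p ≡ 0ℚ
    w-refl (inj₁ a) = same-refl a
    w-refl (inj₂ a) = same-refl a

    w≡0⇒≡ : ∀ p q → w p q ≡ 0ℚ → p ≡ q
    w≡0⇒≡ (inj₁ a) (inj₁ b) eq = cong inj₁ (same≡0 a b eq)
    w≡0⇒≡ (inj₂ a) (inj₂ b) eq = cong inj₂ (same≡0 a b eq)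
    w≡0⇒≡ (inj₁ a) (inj₂ b) eq = contradiction eq (cross≢0 (combine a b))
    w≡0⇒≡ (inj₂ b) (inj₁ a) eq = contradiction eq (cross≢0 (combine a b))

    w-sym : ∀ p q → w p q ≡ w q p
    w-sym (inj₁ a) (inj₁ b) = same-sym a b
    w-sym (inj₂ a) (inj₂ b) = same-sym a b
    w-sym (inj₁ a) (inj₂ b) = refl
    w-sym (inj₂ b) (inj₁ a) = refl

    w-triangle : ∀ p q r → w p r ℚ.≤ w p q ℚ.+ w q r
    w-triangle (inj₁ a) (inj₁ b) (inj₁ c) = same-same a b c
    w-triangle (inj₂ a) (inj₂ b) (inj₂ c) = same-same a b c
    w-triangle (inj₁ a) (inj₂ b) (inj₁ c) = cross-cross a c (combine a b) (combine c b)
    w-triangle (inj₂ a) (inj₁ b) (inj₂ c) = cross-cross a c (combine b a) (combine b c)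
    w-triangle (inj₁ a) (inj₁ b) (inj₂ c) = same-cross (λ i → combine i c) a b
    w-triangle (inj₂ a) (inj₂ b) (inj₁ c) = same-cross (λ i → combine c i) a b
    w-triangle (inj₁ a) (inj₂ b) (inj₂ c) = cross-same (λ i → combine a i) b c
    w-triangle (inj₂ a) (inj₁ b) (inj₁ c) = cross-same (λ i → combine i a) b c

    d : Fin (h ℕ.+ m) → Fin (h ℕ.+ m) → ℝ
    d i j = value binary (X x i j)

    isMetric : IsMetric d
    isMetric = record
      { isSemiMetric = record
        { isQuasiSemiMetric = record
          { isPreMetric = record
            { isProtoMetric = record
              { isPartialOrder  = ≤ᴿ-isPartialOrder
              ; ≈-isEquivalence = ≡.isEquivalence
              ; cong            = λ { {i} {_} {j} refl refl → ≈ᴿ.refl {d i j} }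
              ; nonNegative     = λ {i} {j} → fromℚ-mono (w-nonneg (point i) (point j))
              }
            ; ≈⇒0 = λ { {i} refl → pointwise {d i i} {0ᴿ} (λ _ → w-refl (point i)) }
            }
          ; 0⇒≈ = λ {i} {j} dij≈0 → splitAt-injective i j
              (w≡0⇒≡ (point i) (point j) (fromℚ-injective (w (point i) (point j)) 0ℚ dij≈0))
          }
        ; sym = λ i j → pointwise {d i j} {d j i} (λ _ → w-sym (point i) (point j))
        }
      ; triangle = λ i j k ε 0<ε → always λ _ → ℚ.≤-trans (w-triangle (point i) (point j) (point k))
          (subst (ℚ._≤ w (point i) (point j) ℚ.+ w (point j) (point k) ℚ.+ ε)
            (ℚ.+-identityʳ _) (ℚ.+-monoʳ-≤ (w (point i) (point j) ℚ.+ w (point j) (point k)) (ℚ.<⇒≤ 0<ε)))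
      }
      where
      splitAt-injective : ∀ i j → point i ≡ point j → i ≡ j
      splitAt-injective i j eq = trans (sym (Fin.join-splitAt h m i))
        (trans (cong (join h m) eq) (Fin.join-splitAt h m j))

  module Decoding (α : ℝ) (α<3 : α <ᴿ fromℚ (+ 3 / 1)) where
    open Threshold (+ 3 / 1) (proj₁ α<3) (proj₁ (proj₂ α<3))

    decode : (Fin (h ℕ.+ m) → Fin (h ℕ.+ m) → ℝ) → Bits (h * m)
    decode A = tabulate λ k → above (A (row k) (col k))

    -- An estimate of distance 3 is at least 3, while one of distance 1 is at most `α`, which lies
    -- below 3 by the rational gap in `α<3`. `Threshold` separates these two cases by a decidable
    -- test.
    decode-estimate : ∀ x A → IsEstimate α (d x) A → decode A ≡ x
    decode-estimate x A estimate = trans (tabulate-cong bit-correct) (tabulate∘lookup x)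
      where
      bit-correct : ∀ k → above (A (row k) (col k)) ≡ lookup x k
      bit-correct k = go (lookup x k)
        (subst (λ u → value binary u ≤ᴿ a × a ≤ᴿ α *ᴿ value binary u) (X-row-col x k) (estimate (row k) (col k)))
        where
        a = A (row k) (col k)
        go : ∀ c → let u = if c then three else one in
          value binary u ≤ᴿ a × a ≤ᴿ α *ᴿ value binary u → above a ≡ c
        go true  (3≤a , _) = above-true a 3≤a
        go false (_ , a≤α) = above-false a (α *ᴿ 1ᴿ) a≤α (eventually-map
          (λ n → subst (λ q → q ℚ.+ proj₁ α<3 ℚ.≤ + 3 / 1) (sym (ℚ.*-identityʳ (seq α n))))
          (proj₂ (proj₂ α<3)))

  -- The circuit for the format `binary` is fixed independently of the hidden string, and `decode`
  -- turns each of its outputs into a guess of that string.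
  query-lower-bound : ∀ {T} α → α <ᴿ fromℚ (+ 3 / 1) → (A : Algorithm (h ℕ.+ m) T) →
    SolvesMetricEstimation α A → h * m ≤ T ℕ.+ T
  query-lower-bound α α<3 A solves = learning-lower-bound (λ i j → entry (point i) (point j)) one three (A binary)
    (λ e → decode (Circuit.output (A binary) e))
    (λ x → let S , correct , likely = solves binary (d x) (X x) (isMetric x) (λ i j → ≈ᴿ.refl {d x i j})
           in S , (λ e Se → decode-estimate x (Circuit.output (A binary) e) (correct e Se)) , likely)
    where open Decoding α α<3

-- Balanced halves and the final constant

half-product : ∀ n → 2 ≤ n → n * n ≤ 6 * (ℕ.⌊ n /2⌋ * ℕ.⌈ n /2⌉)
half-product n 2≤n = begin
  n * n                ≤⟨ ℕ.*-mono-≤ n≤3h n≤2m ⟩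
  3 * h * (2 * m)      ≡⟨ solve 2 (λ h m → con 3 :* h :* (con 2 :* m) := con 6 :* (h :* m)) refl h m ⟩
  6 * (h * m)          ∎
  where
  open ℕ.≤-Reasoning
  open Data.Nat.Solver.+-*-Solver
  h = ℕ.⌊ n /2⌋
  m = ℕ.⌈ n /2⌉
  n≤2m : n ≤ 2 * m
  n≤2m = begin
    n            ≡⟨ ℕ.⌊n/2⌋+⌈n/2⌉≡n n ⟨
    h ℕ.+ m      ≤⟨ ℕ.+-mono-≤ (ℕ.⌊n/2⌋≤⌈n/2⌉ n) (ℕ.m≤m+n m 0) ⟩
    2 * m        ∎
  -- Attained at `n = 3` and false at `n = 1`, whence the assumption `2 ≤ n`.
  n≤3h : n ≤ 3 * h
  n≤3h = begin
    n                  ≡⟨ ℕ.⌊n/2⌋+⌈n/2⌉≡n n ⟨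
    -- The ceiling unfolds to the floor of `(n + 1) / 2`, which is at most the floor of
    -- `(n + 2) / 2`, that is, `1 + h`.
    h ℕ.+ m            ≤⟨ ℕ.+-monoʳ-≤ h (ℕ.⌊n/2⌋-mono (ℕ.n≤1+n (suc n))) ⟩
    h ℕ.+ (1 ℕ.+ h)    ≤⟨ ℕ.+-monoʳ-≤ h (ℕ.+-monoˡ-≤ h (ℕ.⌊n/2⌋-mono 2≤n)) ⟩
    h ℕ.+ (h ℕ.+ h)    ≡⟨ solve 1 (λ h → h :+ (h :+ h) := con 3 :* h) refl h ⟩
    3 * h              ∎

mainTheorem5 : ∃[ k ] ∃[ n₀ ] (∀ (n : ℕ) → n₀ ≤ n →
    ∀ (α : ℝ) → 1ᴿ <ᴿ α → α <ᴿ fromℚ (+ 3 / 1) →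
    ∀ (T : ℕ) (A : Algorithm n T) → SolvesMetricEstimation α A →
    n * n ≤ k * T)
mainTheorem5 = 12 , 2 , λ n 2≤n α _ α<3 T A solves → begin
  n * n                              ≤⟨ half-product n 2≤n ⟩
  6 * (ℕ.⌊ n /2⌋ * ℕ.⌈ n /2⌉)        ≤⟨ ℕ.*-monoʳ-≤ 6 (bound ℕ.⌊ n /2⌋ ℕ.⌈ n /2⌉ (ℕ.⌊n/2⌋+⌈n/2⌉≡n n) α α<3 A solves) ⟩
  6 * (T ℕ.+ T)                      ≡⟨ solve 1 (λ t → con 6 :* (t :+ t) := con 12 :* t) refl T ⟩
  12 * T                             ∎
  where
  open ℕ.≤-Reasoning
  open Data.Nat.Solver.+-*-Solver
  -- With `n` generalized, the equation is matched by `refl` and the algorithm needs no transport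
  -- along `h + m ≡ n`.
  bound : ∀ {n T} h m → h ℕ.+ m ≡ n → ∀ α → α <ᴿ fromℚ (+ 3 / 1) → (A : Algorithm n T) →
    SolvesMetricEstimation α A → h * m ≤ T ℕ.+ T
  bound h m refl = Instance.query-lower-bound h m
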